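{- There is an absolute constant $c$ such that for every $n$-vertex graph $G$ and every $r$ with $1\le r\le n/\mathrm{tn}(G)$, $G$ has a three-dimensional drawing with volume at most $c\,n^3/r^2$ and aspect ratio $2r$.
   Context: A three-dimensional drawing of a graph represents the vertices by distinct points of $\mathbb{Z}^3$ and each edge by the straight line-segment between its end-vertices, such that edges intersect only at common end-vertices and an edge meets a vertex only if it is an end-vertex of that edge. If it is contained in an axis-aligned box with side lengths $X-1,Y-1,Z-1$, it is an $X\times Y\times Z$ drawing with volume $XYZ$ and aspect ratio $\max\{X,Y,Z\}/\min\{X,Y,Z\}$. $\mathrm{tn}(G)$ is the track-number: the minimum $t$ such that $V(G)$ can be partitioned into $t$ classes with no edge inside a class, each class totally ordered, with no two edges $vw$, $xy$ with $v,x$ in one class, $w,y$ in another class, $v<x$ and $y<w$.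
   Formalization: The parameter r ranges over rational numbers rather than all real numbers with 1 ≤ r ≤ n/tn(G); the aspect ratio is read as at most 2r. -}

module Defs where

open import Data.Nat as ℕ using (ℕ; _⊔_; _⊓_)
open import Data.Integer as ℤ using (ℤ; +_)
open import Data.Rational as ℚ using (ℚ; _/_; 0ℚ; 1ℚ)
open import Data.Fin using (Fin)
open import Data.Product using (Σ; ∃; ∃-syntax; _×_; _,_)
open import Data.Sum using (_⊎_)
open import Data.Empty using (⊥)
open import Relation.Nullary using (¬_; Dec)
open import Relation.Binary.PropositionalEquality using (_≡_; _≢_)

record Graph (n : ℕ) : Set₁ where
  field
    E      : Fin n → Fin n → Set
    E-dec  : ∀ v w → Dec (E v w)
    E-sym  : ∀ {v w} → E v w → E w v
    E-irr  : ∀ {v} → ¬ E v v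
open Graph public

-- A t-track layout: a partition of the vertices into t (possibly empty)
-- classes via τ, each class totally ordered by the ranking `pos`
-- (injective on each class), no edge inside a class, and no two edges
-- vw, xy with v,x in one class, w,y in another, v < x and y < w.
record TrackLayout {n : ℕ} (G : Graph n) (t : ℕ) : Set where
  field
    τ        : Fin n → Fin t
    pos      : Fin n → ℕ
    pos-inj  : ∀ v w → τ v ≡ τ w → pos v ≡ pos w → v ≡ w
    no-intra : ∀ v w → E G v w → τ v ≢ τ w
    no-X     : ∀ v w x y → E G v w → E G x y →
               τ v ≡ τ x → τ w ≡ τ y →
               ℕ._<_ (pos v) (pos x) → ℕ._<_ (pos y) (pos w) → ⊥

IsTrackNumber : {n : ℕ} → Graph n → ℕ → Set
IsTrackNumber G t = TrackLayout G t × (∀ s → TrackLayout G s → t ℕ.≤ s)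

Point : Set
Point = ℤ × ℤ × ℤ

PointQ : Set
PointQ = ℚ × ℚ × ℚ

ℤ→ℚ : ℤ → ℚ
ℤ→ℚ z = z / 1

ℕ→ℚ : ℕ → ℚ
ℕ→ℚ k = + k / 1

embed : Point → PointQ
embed (a , b , c) = ℤ→ℚ a , ℤ→ℚ b , ℤ→ℚ c

lerp1 : ℚ → ℚ → ℚ → ℚ
lerp1 a b λ′ = a ℚ.+ λ′ ℚ.* (b ℚ.- a)

lerp : Point → Point → ℚ → PointQ
lerp (a₁ , a₂ , a₃) (b₁ , b₂ , b₃) λ′ =
  lerp1 (ℤ→ℚ a₁) (ℤ→ℚ b₁) λ′ , lerp1 (ℤ→ℚ a₂) (ℤ→ℚ b₂) λ′ , lerp1 (ℤ→ℚ a₃) (ℤ→ℚ b₃) λ′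

-- q lies on the closed straight line-segment between a and b.
-- (Rational parameters suffice: intersections of segments between lattice
-- points always contain rational points of the segments.)
OnSeg : PointQ → Point → Point → Set
OnSeg q a b = ∃[ λ′ ] (0ℚ ℚ.≤ λ′ × λ′ ℚ.≤ 1ℚ × q ≡ lerp a b λ′)

record Drawing {n : ℕ} (G : Graph n) : Set where
  field
    p        : Fin n → Point
    p-inj    : ∀ u v → p u ≡ p v → u ≡ v
    vtx-edge : ∀ u v w → E G v w → OnSeg (embed (p u)) (p v) (p w) →
               (u ≡ v) ⊎ (u ≡ w)
    edge-edge : ∀ v w x y → E G v w → E G x y →
                ¬ ((v ≡ x × w ≡ y) ⊎ (v ≡ y × w ≡ x)) →
                ∀ q → OnSeg q (p v) (p w) → OnSeg q (p x) (p y) →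
                ∃[ u ] (((u ≡ v) ⊎ (u ≡ w)) × ((u ≡ x) ⊎ (u ≡ y)) × q ≡ embed (p u))
open Drawing public

-- The drawing is contained in an axis-aligned box with side lengths
-- X-1, Y-1, Z-1 (i.e. an X × Y × Z drawing).
InBox : {n : ℕ} {G : Graph n} → Drawing G → ℕ → ℕ → ℕ → Set
InBox {n} D X Y Z =
  ∃[ x₀ ] ∃[ y₀ ] ∃[ z₀ ] (∀ (v : Fin n) → let (a , b , c) = p D v in
    (x₀ ℤ.≤ a × a ℤ.≤ x₀ ℤ.+ (+ X) ℤ.- (+ 1)) ×
    (y₀ ℤ.≤ b × b ℤ.≤ y₀ ℤ.+ (+ Y) ℤ.- (+ 1)) ×
    (z₀ ℤ.≤ c × c ℤ.≤ z₀ ℤ.+ (+ Z) ℤ.- (+ 1)))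

{-# OPTIONS --safe #-}

-- Cut the lexicographic order of the vertices (by track, then by position) into blocks of
-- h ≈ r consecutive vertices. This refines the t tracks into at most T = t + n/h ≤ 2n/r
-- tracks, each with at most h vertices. For a prime p with T ≤ p = O(n/r), put the vertex of
-- height z on track i at (i, i² mod p, pz + (i³ mod p)), in a p × p × ph box.
-- Modulo p the tracks lie on the moment curve, so by Vandermonde determinants no three
-- track lines are coplanar and edges on four distinct tracks are not coplanar; two edges
-- between the same pair of tracks do not cross because their heights are ordered the same way.
--
-- The prime comes from a weak form of Bertrand's postulate. If there were no primes in (N, M],
-- the product K of the largest prime powers q^e ≤ M over the primes q ≤ N would be a multiple of
-- all k ≤ M, hence of the Leibniz triangle entry (2m+1) C(2m, m) ≥ 2^(m+1) for 2m < M;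
-- but K ≤ M^√M ∏_{q ≤ N} q ≤ M^√M 4^N, which is too small when M ≥ 1024 N.
module Submission where

open import Defs
open import Data.Nat as ℕ using (ℕ; _⊔_; _⊓_; _^_)
open import Data.Rational as ℚ using (ℚ; 1ℚ)
open import Data.Product using (Σ; ∃; ∃-syntax; _×_; _,_)

open import Data.Nat using (zero; suc; NonZero)
import Data.Nat.Properties as ℕ
import Data.Nat.Divisibility as ℕ
open import Data.Nat.DivMod using (_%_; _/_; m≡m%n+[m/n]*n; m%n<n; m/n*n≤m; m/n*n≡m; /-monoˡ-≤)
open import Data.Nat.Primality using (Prime; prime?; euclidsLemma; prime⇒nonZero; prime⇒nonTrivial; ¬prime[0]; ¬prime[1])
import Data.Nat.Tactic.RingSolver as ℕ-Solver
open import Data.Fin using (Fin; zero; suc; toℕ)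
open import Data.Fin.Properties using (toℕ-injective; toℕ<n)
open import Data.Product using (proj₁; proj₂)
open import Data.Sum as Sum using (_⊎_; inj₁; inj₂; [_,_]′)
open import Data.Empty using (⊥; ⊥-elim)
open import Function using (_∘_)
open import Relation.Binary using (tri<; tri≈; tri>)
open import Relation.Nullary using (¬_; Dec; yes; no; contradiction)
open import Relation.Nullary.Decidable using (_×-dec_; _⊎-dec_)
open import Relation.Binary.PropositionalEquality

-- A weak form of Bertrand's postulate.

module WeakBertrand where

  open import Data.Nat
  open import Data.Nat.Properties
  open import Data.Nat.Divisibility
  open import Data.Nat.Primality.Factorisation using (factorise)
  open import Data.Nat.Combinatorics
  open import Data.Nat.Induction using (<-rec)
  open import Data.List using ([]; _∷_)
  open import Data.List.Relation.Unary.All using (_∷_)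
  open ℕ-Solver using (solve-∀)

  -- The symmetric form C(i+j, i): row and column indices avoid subtraction.
  binom : ℕ → ℕ → ℕ
  binom i j = (i + j) C i

  binom-! : ∀ i j → binom i j * (i ! * j !) ≡ (i + j) !
  binom-! i j = begin
    binom i j * (i ! * j !)
      ≡⟨ cong (λ k → binom i j * (i ! * k !)) (sym (m+n∸m≡n i j)) ⟩
    binom i j * (i ! * (i + j ∸ i) !)
      ≡⟨ cong (_* (i ! * (i + j ∸ i) !)) (nCk≡n!/k![n-k]! (m≤m+n i j)) ⟩
    ((i + j) ! / (i ! * (i + j ∸ i) !)) * (i ! * (i + j ∸ i) !)
      ≡⟨ m/n*n≡m (k![n∸k]!∣n! (m≤m+n i j)) ⟩
    (i + j) ! ∎
    where
    open ≡-Reasoning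
    instance _ = i !* (i + j ∸ i) !≢0

  -- This absorption identity and its mirror image `binom-sucʳ` express one entry of the Leibniz
  -- triangle through either of two neighbouring binomial coefficients.
  binom-sucˡ : ∀ i j → suc i * binom (suc i) j ≡ suc (i + j) * binom i j
  binom-sucˡ i j = *-cancelʳ-≡ _ _ (i ! * j !) {{i !* j !≢0}} (begin
    suc i * binom (suc i) j * (i ! * j !)  ≡⟨ regroup (suc i) (binom (suc i) j) (i !) (j !) ⟩
    binom (suc i) j * (suc i ! * j !)      ≡⟨ binom-! (suc i) j ⟩
    suc (i + j) * (i + j) !                ≡⟨ cong (suc (i + j) *_) (sym (binom-! i j)) ⟩
    suc (i + j) * (binom i j * (i ! * j !)) ≡⟨ sym (*-assoc (suc (i + j)) (binom i j) (i ! * j !)) ⟩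
    suc (i + j) * binom i j * (i ! * j !) ∎)
    where
    open ≡-Reasoning
    regroup : ∀ a b c d → a * b * (c * d) ≡ b * (a * c * d)
    regroup = solve-∀

  binom-sucʳ : ∀ i j → suc j * binom i (suc j) ≡ suc (i + j) * binom i j
  binom-sucʳ i j = *-cancelʳ-≡ _ _ (i ! * j !) {{i !* j !≢0}} (begin
    suc j * binom i (suc j) * (i ! * j !)  ≡⟨ regroup (suc j) (binom i (suc j)) (i !) (j !) ⟩
    binom i (suc j) * (i ! * suc j !)      ≡⟨ binom-! i (suc j) ⟩
    (i + suc j) !                          ≡⟨ cong _! (+-suc i j) ⟩
    suc (i + j) * (i + j) !                ≡⟨ cong (suc (i + j) *_) (sym (binom-! i j)) ⟩
    suc (i + j) * (binom i j * (i ! * j !)) ≡⟨ sym (*-assoc (suc (i + j)) (binom i j) (i ! * j !)) ⟩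
    suc (i + j) * binom i j * (i ! * j !) ∎)
    where
    open ≡-Reasoning
    regroup : ∀ a b c d → a * b * (c * d) ≡ b * (c * (a * d))
    regroup = solve-∀

  binom-pascal : ∀ i j → binom i (suc j) + binom (suc i) j ≡ binom (suc i) (suc j)
  binom-pascal i j = begin
    (i + suc j) C i + (suc i + j) C suc i
      ≡⟨ cong (λ n → (i + suc j) C i + n C suc i) (sym (+-suc i j)) ⟩
    (i + suc j) C i + (i + suc j) C suc i
      ≡⟨ nCk+nC[k+1]≡[n+1]C[k+1] (i + suc j) i ⟩
    suc (i + suc j) C suc i ∎
    where open ≡-Reasoning

  -- Bounds on binomial coefficients and the Leibniz triangle.

  nC0≡1 : ∀ n → n C 0 ≡ 1
  nC0≡1 n = trans (nCk≡nC[n∸k] {k = 0} {n = n} z≤n) (nCn≡1 n)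

  nCk≤2^n : ∀ n k → n C k ≤ 2 ^ n
  nCk≤2^n zero zero = ≤-refl
  nCk≤2^n zero (suc k) = z≤n
  nCk≤2^n (suc n) zero = subst (_≤ 2 ^ suc n) (sym (nC0≡1 (suc n))) (m^n>0 2 (suc n))
  nCk≤2^n (suc n) (suc k) = begin
    suc n C suc k            ≡⟨ sym (nCk+nC[k+1]≡[n+1]C[k+1] n k) ⟩
    n C k + n C suc k        ≤⟨ +-mono-≤ (nCk≤2^n n k) (nCk≤2^n n (suc k)) ⟩
    2 ^ n + 2 ^ n            ≡⟨ cong (2 ^ n +_) (sym (+-identityʳ _)) ⟩
    2 ^ suc n ∎
    where open ≤-Reasoning

  binom>0 : ∀ i j → 1 ≤ binom i j
  binom>0 i j = n≢0⇒n>0 λ eq →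
    contradiction (subst (λ b → b * (i ! * j !) ≡ (i + j) !) eq (binom-! i j))
      (≢-sym (≢-nonZero⁻¹ _ {{(i + j) !≢0}}))

  binom-mono : ∀ i j → binom i j ≤ binom i (suc j)
  binom-mono zero j = ≤-reflexive (trans (nC0≡1 j) (sym (nC0≡1 (suc j))))
  binom-mono (suc i) j = ≤-trans (m≤n+m _ _) (≤-reflexive (binom-pascal i j))

  -- Pascal's rule splits the next central coefficient into two equal entries, each at least the
  -- current central one, so every step doubles the bound.
  central-binom≥ : ∀ m → 2 ^ m ≤ binom m m
  central-binom≥ zero = ≤-refl
  central-binom≥ (suc m) = begin
    2 ^ suc m                          ≡⟨ cong (2 ^ m +_) (+-identityʳ _) ⟩
    2 ^ m + 2 ^ m                      ≤⟨ +-mono-≤ ih (≤-trans ih sym≤) ⟩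
    binom m (suc m) + binom (suc m) m  ≡⟨ binom-pascal m m ⟩
    binom (suc m) (suc m) ∎
    where
    open ≤-Reasoning
    ih = ≤-trans (central-binom≥ m) (binom-mono m m)
    sym≤ : binom m (suc m) ≤ binom (suc m) m
    sym≤ = ≤-reflexive (*-cancelˡ-≡ _ _ (suc m) (trans (binom-sucʳ m m) (sym (binom-sucˡ m m))))

  central-binom≤ : ∀ m → binom m m ≤ 4 ^ m
  central-binom≤ m = begin
    binom m m   ≤⟨ nCk≤2^n (m + m) m ⟩
    2 ^ (m + m) ≡⟨ cong (λ k → 2 ^ (m + k)) (sym (+-identityʳ m)) ⟩
    2 ^ (2 * m) ≡⟨ sym (^-*-assoc 2 2 m) ⟩
    4 ^ m ∎
    where open ≤-Reasoning

  -- The hypothesis is 1/D = 1/A − 1/B cleared of denominators, so K/D = K/A − K/B.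
  ∣-reciprocal-difference : ∀ {A B D K} .{{_ : NonZero A}} .{{_ : NonZero B}} →
    A * B + A * D ≡ B * D → A ∣ K → B ∣ K → D ∣ K
  ∣-reciprocal-difference {A} {B} {D} {K} eq (divides a K≡aA) (divides b K≡bB) =
    ∣m+n∣m⇒∣n (subst (D ∣_) aD≡bD+K (n∣m*n a)) (n∣m*n b)
    where
    open ≡-Reasoning
    s₁ : ∀ a A B D → a * D * (A * B) ≡ (a * A) * (B * D)
    s₁ = solve-∀
    s₂ : ∀ b A B D K → K * (A * B) + (b * B) * (A * D) ≡ (b * D + K) * (A * B)
    s₂ = solve-∀
    aD≡bD+K : a * D ≡ b * D + K
    aD≡bD+K = *-cancelʳ-≡ _ _ (A * B) {{m*n≢0 A B}} (begin
      a * D * (A * B)              ≡⟨ s₁ a A B D ⟩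
      (a * A) * (B * D)            ≡⟨ cong₂ _*_ (sym K≡aA) (sym eq) ⟩
      K * (A * B + A * D)          ≡⟨ *-distribˡ-+ K (A * B) (A * D) ⟩
      K * (A * B) + K * (A * D)    ≡⟨ cong (λ z → K * (A * B) + z * (A * D)) K≡bB ⟩
      K * (A * B) + (b * B) * (A * D) ≡⟨ s₂ b A B D K ⟩
      (b * D + K) * (A * B) ∎)

  -- Write L(i, j) for the entry. Since 1/L(i+1, j) = 1/L(i, j) - 1/L(i, j+1), divisibility spreads
  -- by induction on `i` from the border entries L(0, j) = j + 1, which are among the numbers
  -- assumed to divide `K`.
  leibniz-∣ : ∀ {M K} → (∀ k → 1 ≤ k → k ≤ M → k ∣ K) →
              ∀ i j → i + j < M → suc (i + j) * binom i j ∣ K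
  leibniz-∣ {M} {K} all zero j j<M =
    subst (_∣ K) (sym (trans (cong (suc j *_) (nC0≡1 j)) (*-identityʳ (suc j)))) (all (suc j) (s≤s z≤n) j<M)
  leibniz-∣ {M} {K} all (suc i) j lt =
    ∣-reciprocal-difference {A} {B} {{A≢0}} {{B≢0}} relation
      (leibniz-∣ all i j (<-trans (n<1+n _) lt))
      (leibniz-∣ all i (suc j) (subst (_< M) (sym (+-suc i j)) lt))
    where
    open ≡-Reasoning
    A = suc (i + j) * binom i j
    B = suc (i + suc j) * binom i (suc j)
    x = binom (suc i) j
    y = binom i (suc j)
    s = suc (suc i + j)
    A≢0 : NonZero A
    A≢0 = m*n≢0 (suc (i + j)) _ {{_}} {{>-nonZero (binom>0 i j)}}
    B≢0 : NonZero B
    B≢0 = m*n≢0 (suc (i + suc j)) _ {{_}} {{>-nonZero (binom>0 i (suc j))}}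
    B≡ : B ≡ s * y
    B≡ = cong (λ n → suc n * y) (+-suc i j)
    reorder : ∀ i j x y → (suc i * x) * (suc (suc i + j) * y) + (suc j * y) * (suc (suc i + j) * x)
            ≡ (suc (suc i + j) * y) * (suc (suc i + j) * x)
    reorder = solve-∀
    -- The absorption identities give A = (i+1)x = (j+1)y. Using one form in each summand leaves
    -- only (i+1) + (j+1) = s.
    relation : A * B + A * (s * x) ≡ B * (s * x)
    relation = begin
      A * B + A * (s * x)
        ≡⟨ cong₂ _+_ (cong₂ _*_ (sym (binom-sucˡ i j)) B≡) (cong (_* (s * x)) (sym (binom-sucʳ i j))) ⟩
      (suc i * x) * (s * y) + (suc j * y) * (s * x)
        ≡⟨ reorder i j x y ⟩
      (s * y) * (s * x)
        ≡⟨ cong (_* (s * x)) (sym B≡) ⟩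
      B * (s * x) ∎

  -- Prime factors and the primorial.

  prime-divisor : ∀ n .{{_ : NonZero n}} → n ≢ 1 → ∃[ q ] (Prime q × q ∣ n)
  prime-divisor n n≢1 with factorise n
  ... | record { factors = []    ; isFactorisation = eq } = contradiction eq n≢1
  ... | record { factors = q ∷ _ ; isFactorisation = eq ; factorsPrime = q-prime ∷ _ } =
    q , q-prime , subst (q ∣_) (sym eq) (m∣m*n _)

  prime∣!⇒≤ : ∀ {q} → Prime q → ∀ n → q ∣ n ! → q ≤ n
  prime∣!⇒≤ q-prime zero q∣1 = contradiction (subst Prime (∣1⇒≡1 q∣1) q-prime) ¬prime[1]
  prime∣!⇒≤ q-prime (suc n) q∣ with euclidsLemma (suc n) (n !) q-prime q∣
  ... | inj₁ q∣1+n = ∣⇒≤ q∣1+n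
  ... | inj₂ q∣n!  = m≤n⇒m≤1+n (prime∣!⇒≤ q-prime n q∣n!)

  -- The prime divides (2m)! = C(2m, m) m! m!, but exceeds every factor of m!, so Euclid's lemma
  -- leaves only the binomial coefficient.
  prime∣central-binom : ∀ {q m} → Prime q → m < q → q ≤ m + m → q ∣ binom m m
  prime∣central-binom {q@(suc q-1)} {m} q-prime m<q q≤2m
    with euclidsLemma (binom m m) (m ! * m !) q-prime
           (subst (q ∣_) (sym (binom-! m m)) (∣-trans (m∣m*n (q-1 !)) (m≤n⇒m!∣n! q≤2m)))
  ... | inj₁ q∣b = q∣b
  ... | inj₂ q∣m!m! with euclidsLemma (m !) (m !) q-prime q∣m!m!
  ...   | inj₁ q∣m! = contradiction (prime∣!⇒≤ q-prime m q∣m!) (<⇒≱ m<q)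
  ...   | inj₂ q∣m! = contradiction (prime∣!⇒≤ q-prime m q∣m!) (<⇒≱ m<q)

  ifPrime : (ℕ → ℕ) → ℕ → ℕ
  ifPrime f q with prime? q
  ... | yes _ = f q
  ... | no  _ = 1

  -- Leaving the factor at each prime open lets the primorial and the product of the largest prime
  -- powers be compared factor by factor.
  primeProduct : (ℕ → ℕ) → ℕ → ℕ
  primeProduct f zero    = 1
  primeProduct f (suc n) = primeProduct f n * ifPrime f (suc n)

  primorial : ℕ → ℕ
  primorial = primeProduct (λ q → q)

  primorial≥1 : ∀ n → 1 ≤ primorial n
  primorial≥1 zero = ≤-refl
  primorial≥1 (suc n) with prime? (suc n)
  ... | yes _ = *-mono-≤ (primorial≥1 n) (s≤s {0} {n} z≤n)
  ... | no  _ = *-mono-≤ (primorial≥1 n) (≤-refl {1})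

  prime∣primorial⇒≤ : ∀ {q} → Prime q → ∀ n → q ∣ primorial n → q ≤ n
  prime∣primorial⇒≤ q-prime zero q∣1 = contradiction (subst Prime (∣1⇒≡1 q∣1) q-prime) ¬prime[1]
  prime∣primorial⇒≤ {q} q-prime (suc n) q∣ with prime? (suc n)
  ... | no _ = m≤n⇒m≤1+n (prime∣primorial⇒≤ q-prime n (subst (q ∣_) (*-identityʳ _) q∣))
  ... | yes _ with euclidsLemma (primorial n) (suc n) q-prime q∣
  ...   | inj₁ q∣P = m≤n⇒m≤1+n (prime∣primorial⇒≤ q-prime n q∣P)
  ...   | inj₂ q∣r = ∣⇒≤ q∣r

  -- Going from `m` up to `m + d`, each new prime divides C(2m, m) and is coprime to the part
  -- already collected, so it can be split off the cofactor. The bound `d ≤ m` keeps these primes at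
  -- most 2m.
  primorial-∣ : ∀ m d → d ≤ m → primorial (m + d) ∣ primorial m * binom m m
  primorial-∣ m zero _ = subst (λ k → primorial k ∣ primorial m * binom m m) (sym (+-identityʳ m)) (m∣m*n (binom m m))
  primorial-∣ m (suc d) d<m rewrite +-suc m d with primorial-∣ m d (<⇒≤ d<m) | prime? (suc (m + d))
  ... | ih | no _ = subst (_∣ primorial m * binom m m) (sym (*-identityʳ _)) ih
  ... | divides c eq | yes q-prime = divides c′ (begin
      primorial m * binom m m   ≡⟨ eq ⟩
      c * primorial (m + d)     ≡⟨ cong (_* primorial (m + d)) c≡ ⟩
      c′ * q * primorial (m + d) ≡⟨ *-assoc c′ q _ ⟩
      c′ * (q * primorial (m + d)) ≡⟨ cong (c′ *_) (*-comm q _) ⟩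
      c′ * (primorial (m + d) * q) ∎)
    where
    open ≡-Reasoning
    q = suc (m + d)
    q∣b : q ∣ binom m m
    q∣b = prime∣central-binom {m = m} q-prime (s≤s (m≤m+n m d)) (subst (_≤ m + m) (+-suc m d) (+-monoʳ-≤ m d<m))
    q∣c : q ∣ c
    q∣c with euclidsLemma c (primorial (m + d)) q-prime (subst (q ∣_) eq (∣n⇒∣m*n (primorial m) q∣b))
    ... | inj₁ p = p
    ... | inj₂ p = contradiction (prime∣primorial⇒≤ q-prime (m + d) p) 1+n≰n
    c′ = quotient q∣c
    c≡ : c ≡ c′ * q
    c≡ = m∣n⇒n≡quotient*m q∣c

  primorial-double : ∀ m → primorial (m + m) ≤ primorial m * 4 ^ m
  primorial-double m = ≤-trans
    (∣⇒≤ {{m*n≢0 _ _ {{>-nonZero (primorial≥1 m)}} {{>-nonZero (binom>0 m m)}}}} (primorial-∣ m m ≤-refl))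
    (*-monoʳ-≤ (primorial m) (central-binom≤ m))

  -- Doubling `m` costs a factor `4 ^ m`, exactly the growth from `4 ^ m` to `4 ^ (m + m)`. Powers
  -- of two suffice because the lower end of the prime gap is later chosen to be one.
  primorial-2^ : ∀ j → primorial (2 ^ j) ≤ 4 ^ (2 ^ j)
  primorial-2^ zero = s≤s z≤n
  primorial-2^ (suc j) rewrite +-identityʳ (2 ^ j) = begin
    primorial (m + m)   ≤⟨ primorial-double m ⟩
    primorial m * 4 ^ m ≤⟨ *-monoˡ-≤ (4 ^ m) (primorial-2^ j) ⟩
    4 ^ m * 4 ^ m       ≡⟨ sym (^-distribˡ-+-* 4 m m) ⟩
    4 ^ (m + m) ∎
    where
    open ≤-Reasoning
    m = 2 ^ j

  -- Largest prime powers and smooth numbers.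

  log-exists : ∀ q → 2 ≤ q → ∀ M → ∃[ e ] (q ^ e ≤ suc M × suc M < q ^ suc e)
  log-exists q 2≤q zero = 0 , ≤-refl , subst (1 <_) (sym (*-identityʳ q)) 2≤q
  log-exists q 2≤q (suc M) with log-exists q 2≤q M
  -- When the target grows by one, the exponent grows by at most one: the power after `q ^ suc e` is
  -- at least twice as large, hence overshoots. The target `suc M` is positive, so exponent 0 is a
  -- valid start.
  ... | e , lo , hi with q ^ suc e ≤? suc (suc M)
  ...   | no  ≰ = e , m≤n⇒m≤1+n lo , ≰⇒> ≰
  ...   | yes ≤ = suc e , ≤ , (begin-strict
          suc (suc M)       ≤⟨ hi ⟩
          q ^ suc e         <⟨ m<m+n (q ^ suc e) (≤-trans (s≤s z≤n) hi) ⟩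
          q ^ suc e + q ^ suc e ≡⟨ cong (q ^ suc e +_) (sym (+-identityʳ _)) ⟩
          2 * q ^ suc e     ≤⟨ *-monoˡ-≤ (q ^ suc e) 2≤q ⟩
          q ^ suc (suc e) ∎)
    where open ≤-Reasoning

  prime≥2 : ∀ {q} → Prime q → 2 ≤ q
  prime≥2 {zero} pr = contradiction pr ¬prime[0]
  prime≥2 {suc zero} pr = contradiction pr ¬prime[1]
  prime≥2 {suc (suc q)} pr = s≤s (s≤s z≤n)

  -- For q ≤ 1 there is no largest power, and the value 1 is junk.
  maxPower : ℕ → ℕ → ℕ
  maxPower M q with 2 ≤? q
  ... | yes 2≤q = q ^ proj₁ (log-exists q 2≤q M)
  ... | no  _   = 1

  maxPower≤ : ∀ M q → maxPower M q ≤ suc M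
  maxPower≤ M q with 2 ≤? q
  ... | yes 2≤q = proj₁ (proj₂ (log-exists q 2≤q M))
  ... | no  _   = s≤s z≤n

  ^-∣-^ : ∀ q {m n} → m ≤ n → q ^ m ∣ q ^ n
  ^-∣-^ q {m} {n} m≤n = divides (q ^ (n ∸ m)) (begin
    q ^ n               ≡⟨ cong (q ^_) (sym (m∸n+n≡m m≤n)) ⟩
    q ^ (n ∸ m + m)     ≡⟨ ^-distribˡ-+-* q (n ∸ m) m ⟩
    q ^ (n ∸ m) * q ^ m ∎)
    where open ≡-Reasoning

  power-∣-maxPower : ∀ {M q} → 2 ≤ q → ∀ e → q ^ e ≤ suc M → q ^ e ∣ maxPower M q
  power-∣-maxPower {M} {q} 2≤q e q^e≤ with 2 ≤? q
  ... | no  ≰ = contradiction 2≤q ≰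
  ... | yes p with log-exists q p M
  ...   | e′ , _ , hi with e ≤? e′
  ...     | yes e≤e′ = ^-∣-^ q e≤e′
  ...     | no  e≰e′ = contradiction
              (≤-<-trans q^e≤ hi)
              (≤⇒≯ (^-monoʳ-≤ q {{>-nonZero (≤-trans (s≤s z≤n) 2≤q)}} (≰⇒> e≰e′)))

  maxPower≤base : ∀ {M q} → 2 ≤ q → suc M < q * q → maxPower M q ≤ q
  maxPower≤base {M} {q} 2≤q M<q² with 2 ≤? q
  ... | no  ≰ = contradiction 2≤q ≰
  ... | yes p with log-exists q p M
  ...   | zero , _ = ≤-trans (s≤s z≤n) 2≤q
  ...   | suc zero , _ = ≤-reflexive (*-identityʳ q)
  ...   | suc (suc e) , lo , _ = contradiction (<-≤-trans M<q² q²≤) (≤⇒≯ lo)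
    where
    instance _ = >-nonZero {q} (≤-trans (s≤s z≤n) 2≤q)
    q²≤ : q * q ≤ q ^ suc (suc e)
    q²≤ = *-monoʳ-≤ q (m≤m*n q (q ^ e) {{m^n≢0 q e}})

  remove-prime-power : ∀ {q} → Prime q → ∀ k → 1 ≤ k →
    ∃[ e ] ∃[ k′ ] (k ≡ q ^ e * k′ × ¬ (q ∣ k′))
  remove-prime-power {q} q-prime = <-rec _ step
    where
    step : ∀ k → (∀ {l} → l < k → 1 ≤ l → ∃[ e ] ∃[ k′ ] (l ≡ q ^ e * k′ × ¬ (q ∣ k′))) →
           1 ≤ k → ∃[ e ] ∃[ k′ ] (k ≡ q ^ e * k′ × ¬ (q ∣ k′))
    step k rec 1≤k with q ∣? k
    ... | no  q∤k = 0 , k , sym (+-identityʳ k) , q∤k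
    ... | yes q∣k = let e , k′ , eq , q∤k′ = rec l<k 1≤l
                    in suc e , k′ , trans (m∣n⇒n≡m*quotient q∣k) (trans (cong (q *_) eq) (sym (*-assoc q _ k′))) , q∤k′
      where
      l = quotient q∣k
      instance
        _ = >-nonZero 1≤k
        _ = prime⇒nonTrivial q-prime
      l<k : l < k
      l<k = quotient-< q∣k
      1≤l : 1 ≤ l
      1≤l = >-nonZero⁻¹ l {{quotient≢0 q∣k}}

  -- Induction on the bound for the prime factors: if `suc n` is prime, its full power is removed
  -- from `k`. That power divides the matching `maxPower` factor, and the cofactor has only prime
  -- factors up to `n`.
  smooth-∣ : ∀ M n k → 1 ≤ k → k ≤ suc M → (∀ {q} → Prime q → q ∣ k → q ≤ n) →
             k ∣ primeProduct (maxPower M) n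
  smooth-∣ M zero k 1≤k k≤M smooth with k ≟ 1
  ... | yes k≡1 = ∣-reflexive k≡1
  ... | no  k≢1 with prime-divisor k {{>-nonZero 1≤k}} k≢1
  -- With bound 0 no prime may divide `k`, so `k` can only be 1.
  ...   | q , q-prime , q∣k = contradiction (smooth q-prime q∣k) (<⇒≱ (≤-trans (s≤s z≤n) (prime≥2 q-prime)))
  smooth-∣ M (suc n) k 1≤k k≤M smooth with prime? (suc n)
  ... | no ¬prime = subst (k ∣_) (sym (*-identityʳ _)) (smooth-∣ M n k 1≤k k≤M smooth′)
    where
    smooth′ : ∀ {q} → Prime q → q ∣ k → q ≤ n
    smooth′ q-prime q∣k = ≤-pred (≤∧≢⇒< (smooth q-prime q∣k) λ eq → ¬prime (subst Prime eq q-prime))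
  ... | yes r-prime with remove-prime-power r-prime k 1≤k
  ...   | e , k′ , refl , r∤k′ =
    subst (_∣ primeProduct (maxPower M) n * maxPower M (suc n)) (*-comm k′ (suc n ^ e))
      (*-pres-∣ (smooth-∣ M n k′ (>-nonZero⁻¹ k′) (≤-trans (m≤n*m k′ (suc n ^ e)) k≤M) smooth′)
                (power-∣-maxPower (prime≥2 r-prime) e (≤-trans (m≤m*n (suc n ^ e) k′) k≤M)))
    where
    instance
      r^e≢0 : NonZero (suc n ^ e)
      r^e≢0 = m^n≢0 (suc n) e
      k′≢0 : NonZero k′
      k′≢0 = m*n≢0⇒n≢0 (suc n ^ e) {{>-nonZero 1≤k}}
    smooth′ : ∀ {q} → Prime q → q ∣ k′ → q ≤ n
    smooth′ {q} q-prime q∣k′ = ≤-pred (≤∧≢⇒< (smooth q-prime (∣n⇒∣m*n (suc n ^ e) q∣k′))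
      λ eq → r∤k′ (subst (_∣ k′) eq q∣k′))

  ifPrime-≤ : ∀ {f b} q → 1 ≤ b → f q ≤ b → ifPrime f q ≤ b
  ifPrime-≤ q 1≤b fq≤b with prime? q
  ... | yes _ = fq≤b
  ... | no  _ = 1≤b

  primeProduct≤^ : ∀ {f b} → 1 ≤ b → (∀ q → f q ≤ b) → ∀ n → primeProduct f n ≤ b ^ n
  primeProduct≤^ 1≤b f≤b zero = ≤-refl
  primeProduct≤^ {f} {b} 1≤b f≤b (suc n) = subst (primeProduct f n * ifPrime f (suc n) ≤_) (*-comm (b ^ n) b)
    (*-mono-≤ (primeProduct≤^ 1≤b f≤b n) (ifPrime-≤ (suc n) 1≤b (f≤b (suc n))))

  -- Primes above √(suc M) enter with exponent one, so only √(suc M) factors can be as large as suc M.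
  primeProduct-maxPower≤ : ∀ M s → suc M ≤ s * s → ∀ n →
    primeProduct (maxPower M) n ≤ suc M ^ s * primorial n
  primeProduct-maxPower≤ M s M≤s² zero = ≤-trans (m^n>0 (suc M) s) (≤-reflexive (sym (*-identityʳ _)))
  primeProduct-maxPower≤ M s M≤s² (suc n) with suc n ≤? s
  ... | yes n<s = begin
    primeProduct (maxPower M) (suc n) ≤⟨ primeProduct≤^ (s≤s z≤n) (maxPower≤ M) (suc n) ⟩
    suc M ^ suc n                     ≤⟨ ^-monoʳ-≤ (suc M) n<s ⟩
    suc M ^ s                         ≤⟨ m≤m*n (suc M ^ s) (primorial (suc n)) {{>-nonZero (primorial≥1 (suc n))}} ⟩
    suc M ^ s * primorial (suc n) ∎
    where open ≤-Reasoning
  ... | no n≮s = begin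
    primeProduct (maxPower M) n * ifPrime (maxPower M) (suc n)
      ≤⟨ *-mono-≤ (primeProduct-maxPower≤ M s M≤s² n) factor≤ ⟩
    suc M ^ s * primorial n * ifPrime (λ q → q) (suc n)
      ≡⟨ *-assoc (suc M ^ s) (primorial n) (ifPrime (λ q → q) (suc n)) ⟩
    suc M ^ s * primorial (suc n) ∎
    where
    open ≤-Reasoning
    factor≤ : ifPrime (maxPower M) (suc n) ≤ ifPrime (λ q → q) (suc n)
    factor≤ with prime? (suc n)
    ... | no _ = ≤-refl
    ... | yes r-prime = maxPower≤base (prime≥2 r-prime)
          (≤-<-trans M≤s² (*-mono-< (≰⇒> n≮s) (≰⇒> n≮s)))

  -- Comparison of the two bounds and choice of the range.

  ^-cancel-≤ : ∀ {m n} → 2 ^ m ≤ 2 ^ n → m ≤ n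
  ^-cancel-≤ {m} {n} le with m ≤? n
  ... | yes m≤n = m≤n
  ... | no  m≰n = contradiction le (<⇒≱ (^-monoʳ-< 2 (s≤s (s≤s z≤n)) (≰⇒> m≰n)))

  no-primes⇒bound : ∀ N M m s → m + m < suc M → 1 ≤ m → suc M ≤ s * s →
    (∀ q → Prime q → N < q → q ≤ suc M → ⊥) →
    2 ^ suc m ≤ suc M ^ s * primorial N
  no-primes⇒bound N M m s 2m<M 1≤m M≤s² none = begin
    -- The factor 2m + 1 is at least 2; this pays for the exponent `suc m`.
    2 * 2 ^ m                     ≤⟨ *-mono-≤ {2} {suc (m + m)} (s≤s (≤-trans 1≤m (m≤m+n m m))) (central-binom≥ m) ⟩
    suc (m + m) * binom m m       ≤⟨ ∣⇒≤ {{K≢0}} (leibniz-∣ all∣K m m 2m<M) ⟩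
    K                             ≤⟨ primeProduct-maxPower≤ M s M≤s² N ⟩
    suc M ^ s * primorial N ∎
    where
    open ≤-Reasoning
    K = primeProduct (maxPower M) N
    all∣K : ∀ k → 1 ≤ k → k ≤ suc M → k ∣ K
    -- A prime factor of `k` is at most `suc M`; as the gap contains no primes, it is at most `N`.
    all∣K k 1≤k k≤M = smooth-∣ M N k 1≤k k≤M λ {q} q-prime q∣k →
      ≮⇒≥ λ N<q → none q q-prime N<q (≤-trans (∣⇒≤ {{>-nonZero 1≤k}} q∣k) k≤M)
    maxPower≢0 : ∀ q → 1 ≤ maxPower M q
    maxPower≢0 q with 2 ≤? q
    ... | yes 2≤q = m^n>0 q {{>-nonZero (≤-trans (s≤s z≤n) 2≤q)}} (proj₁ (log-exists q 2≤q M))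
    ... | no _ = ≤-refl
    product≥1 : ∀ n → 1 ≤ primeProduct (maxPower M) n
    product≥1 zero = ≤-refl
    product≥1 (suc n) with prime? (suc n)
    ... | yes _ = *-mono-≤ (product≥1 n) (maxPower≢0 (suc n))
    ... | no  _ = *-mono-≤ (product≥1 n) (≤-refl {1})
    K≢0 : NonZero K
    K≢0 = >-nonZero (product≥1 N)

  -- The start 5 is where the inequality begins to hold for good: 30 ≤ 32, but 24 > 16. It fixes √M
  -- = 2^(5+j), and so the factor 1024 between the ends of the range.
  6e≤2^e : ∀ j → 6 * (5 + j) ≤ 2 ^ (5 + j)
  6e≤2^e zero = m≤m+n 30 2
  6e≤2^e (suc j) = begin
    6 * (5 + suc j)           ≡⟨ cong (6 *_) (+-suc 5 j) ⟩
    6 * suc (5 + j)           ≡⟨ *-suc 6 (5 + j) ⟩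
    6 + 6 * (5 + j)           ≤⟨ +-mono-≤ (≤-trans (m≤m*n 6 (5 + j)) (6e≤2^e j)) (6e≤2^e j) ⟩
    2 ^ (5 + j) + 2 ^ (5 + j) ≡⟨ cong (2 ^ (5 + j) +_) (sym (+-identityʳ _)) ⟩
    2 ^ (5 + suc j) ∎
    where open ≤-Reasoning

  -- With x = √M and M = 2H, comparing the two bounds on the product of prime powers
  -- gives 2^H ≤ M^x 4^N, i.e. H ≤ 2ex + 2N, which is impossible once N ≤ H/8 and 6e ≤ x.
  no-primes⇒⊥ : ∀ e i H → 1 < H → 2 ^ e * 2 ^ e ≡ H + H → 8 * 2 ^ i ≤ H → 6 * e ≤ 2 ^ e →
    ¬ (∀ q → Prime q → 2 ^ i < q → q ≤ H + H → ⊥)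
  no-primes⇒⊥ e i (suc m) (s≤s 1≤m) x²≡2H 8N≤H 6e≤x none = contradiction H≤6N (<⇒≱ 6N<H)
    where
    open ≤-Reasoning
    H = suc m
    N = 2 ^ i
    x = 2 ^ e
    6N<H : 6 * N < H
    6N<H = <-≤-trans (*-monoˡ-< N {{m^n≢0 2 i}} (m≤m+n 7 1)) 8N≤H
    2^H≤ : 2 ^ H ≤ 2 ^ ((e + e) * x + 2 * N)
    2^H≤ = begin
      2 ^ H                              ≤⟨ no-primes⇒bound N (m + H) m x
                                              (s≤s (+-monoʳ-≤ m (n≤1+n m))) 1≤m (≤-reflexive (sym x²≡2H)) none ⟩
      (H + H) ^ x * primorial N          ≤⟨ *-monoʳ-≤ ((H + H) ^ x) (primorial-2^ i) ⟩
      (H + H) ^ x * 4 ^ N                ≡⟨ cong (λ k → k ^ x * 4 ^ N) (trans (sym x²≡2H) (sym (^-distribˡ-+-* 2 e e))) ⟩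
      (2 ^ (e + e)) ^ x * 4 ^ N          ≡⟨ cong₂ _*_ (^-*-assoc 2 (e + e) x) (^-*-assoc 2 2 N) ⟩
      2 ^ ((e + e) * x) * 2 ^ (2 * N)    ≡⟨ sym (^-distribˡ-+-* 2 ((e + e) * x) (2 * N)) ⟩
      2 ^ ((e + e) * x + 2 * N) ∎
    reorder : ∀ e x N → 6 * ((e + e) * x + 2 * N) ≡ 2 * ((6 * e) * x) + 2 * (6 * N)
    reorder = solve-∀
    regroup : ∀ h n → 2 * (h + h) + 2 * n ≡ 4 * h + 2 * n
    regroup = solve-∀
    H≤6N : H ≤ 6 * N
    -- Scaled by 6, the comparison reads 6H ≤ 2(6e)x + 12N ≤ 2x² + 12N = 4H + 12N, that is H ≤ 6N,
    -- against 8N ≤ H.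
    H≤6N = *-cancelˡ-≤ 2 (+-cancelˡ-≤ (4 * H) (2 * H) (2 * (6 * N)) (begin
      4 * H + 2 * H                   ≡⟨ sym (*-distribʳ-+ H 4 2) ⟩
      6 * H                           ≤⟨ *-monoʳ-≤ 6 (^-cancel-≤ {H} {(e + e) * x + 2 * N} 2^H≤) ⟩
      6 * ((e + e) * x + 2 * N)       ≡⟨ reorder e x N ⟩
      2 * ((6 * e) * x) + 2 * (6 * N) ≤⟨ +-monoˡ-≤ (2 * (6 * N)) (*-monoʳ-≤ 2 (*-monoˡ-≤ x 6e≤x)) ⟩
      2 * (x * x) + 2 * (6 * N)       ≡⟨ cong (λ k → 2 * k + 2 * (6 * N)) x²≡2H ⟩
      2 * (H + H) + 2 * (6 * N)       ≡⟨ regroup H (6 * N) ⟩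
      4 * H + 2 * (6 * N) ∎))

  -- The ends are N = 4^j and M = 1024 N = (2^(5+j))². The even exponents make √M a power of two, so
  -- no integer square roots arise.
  prime-in-range : ∀ j → ∃[ q ] (Prime q × 2 ^ (j + j) < q × q ≤ 2 ^ (9 + (j + j)) + 2 ^ (9 + (j + j)))
  prime-in-range j = search (2 ^ (j + j)) (2 ^ (9 + (j + j)))
    (no-primes⇒⊥ (5 + j) (j + j) (2 ^ (9 + (j + j))) 1<H x²≡2H 8N≤H (6e≤2^e j))
    where
    search : ∀ N H → ¬ (∀ q → Prime q → N < q → q ≤ H + H → ⊥) →
             ∃[ q ] (Prime q × N < q × q ≤ H + H)
    -- Primality is decidable and the range is finite, so a bounded search turns the refuted absence
    -- of primes into an actual prime.
    search N H ¬none with anyUpTo? (λ q → prime? q ×-dec (N <? q)) (suc (H + H))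
    ... | yes (q , q<1+2H , q-prime , N<q) = q , q-prime , N<q , ≤-pred q<1+2H
    ... | no none = contradiction (λ q q-prime N<q q≤2H → none (q , s≤s q≤2H , q-prime , N<q)) ¬none
    exponents : ∀ j → (5 + j) + (5 + j) ≡ 10 + (j + j)
    exponents = solve-∀
    1<H : 1 < 2 ^ (9 + (j + j))
    1<H = ^-monoʳ-< 2 (s≤s (s≤s z≤n)) {0} {9 + (j + j)} (s≤s z≤n)
    x²≡2H : 2 ^ (5 + j) * 2 ^ (5 + j) ≡ 2 ^ (9 + (j + j)) + 2 ^ (9 + (j + j))
    x²≡2H = trans (sym (^-distribˡ-+-* 2 (5 + j) (5 + j)))
              (trans (cong (2 ^_) (exponents j)) (cong (2 ^ (9 + (j + j)) +_) (+-identityʳ (2 ^ (9 + (j + j))))))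
    8N≤H : 8 * 2 ^ (j + j) ≤ 2 ^ (9 + (j + j))
    8N≤H = ≤-trans (≤-reflexive (sym (^-distribˡ-+-* 2 3 (j + j))))
             (^-monoʳ-≤ 2 {3 + (j + j)} {9 + (j + j)} (+-monoˡ-≤ (j + j) (m≤m+n 3 6)))

  weak-bertrand : ∃[ c ] (∀ n → 1 ≤ n → ∃[ q ] (Prime q × n ≤ q × q ≤ c * n))
  -- If 4^e ≤ n < 4^(e+1), the range starting at 4^(e+1) ends at 1024 · 4^(e+1) = 2^12 · 4^e ≤ 2^12
  -- n.
  weak-bertrand = 2 ^ 12 , λ { (suc n) _ → bertrand n }
    where
    open ≤-Reasoning
    bertrand : ∀ n → ∃[ q ] (Prime q × suc n ≤ q × q ≤ 2 ^ 12 * suc n)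
    bertrand n with log-exists 4 (m≤m+n 2 2) n
    ... | e , 4^e≤ , <4^1+e with prime-in-range (suc e)
    ...   | q , q-prime , N<q , q≤ = q , q-prime
      , <⇒≤ (<-trans <4^1+e (subst (_< q) (trans (cong (2 ^_) (double (suc e))) (sym (^-*-assoc 2 2 (suc e)))) N<q))
      , (begin
          q                             ≤⟨ q≤ ⟩
          2 ^ (9 + (suc e + suc e)) + 2 ^ (9 + (suc e + suc e))
            ≡⟨ cong (2 ^ (9 + (suc e + suc e)) +_) (sym (+-identityʳ (2 ^ (9 + (suc e + suc e))))) ⟩
          2 ^ (10 + (suc e + suc e))    ≡⟨ cong (2 ^_) (shift e) ⟩
          2 ^ (12 + 2 * e)              ≡⟨ ^-distribˡ-+-* 2 12 (2 * e) ⟩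
          2 ^ 12 * 2 ^ (2 * e)          ≡⟨ cong (2 ^ 12 *_) (sym (^-*-assoc 2 2 e)) ⟩
          2 ^ 12 * 4 ^ e                ≤⟨ *-monoʳ-≤ (2 ^ 12) 4^e≤ ⟩
          2 ^ 12 * suc n ∎)
      where
      double : ∀ k → k + k ≡ 2 * k
      double = solve-∀
      shift : ∀ e → 10 + (suc e + suc e) ≡ 12 + 2 * e
      shift = solve-∀

open import Data.Integer as ℤ using (ℤ; +_; ∣_∣)
import Data.Integer.Properties as ℤ
import Data.Integer.Tactic.RingSolver as ℤ-Solver
open import Data.Rational using (mkℚ; toℚᵘ)
import Data.Rational.Properties as ℚ
open import Data.Rational.Unnormalised as ℚᵘ using (mkℚᵘ; *≡*; *≤*)
import Data.Rational.Unnormalised.Properties as ℚᵘ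

-- Determinants and segments between lattice points.

module Geometry where

  open import Data.Integer using (_+_; _*_; _-_; -_)
  open ℤ-Solver using (solve-∀)

  -- Opaque, because unification would otherwise unfold integer multiplication.
  opaque
    det₂ : ℤ → ℤ → ℤ → ℤ → ℤ
    det₂ a₁ a₂ b₁ b₂ = a₁ * b₂ - a₂ * b₁

    det₃ : ℤ → ℤ → ℤ → ℤ → ℤ → ℤ → ℤ → ℤ → ℤ → ℤ
    det₃ a₁ a₂ a₃ b₁ b₂ b₃ c₁ c₂ c₃ =
      a₁ * (b₂ * c₃ - b₃ * c₂) + a₂ * (b₃ * c₁ - b₁ * c₃) + a₃ * (b₁ * c₂ - b₂ * c₁)

    det₂-vandermonde : ∀ i j l →
      det₂ (i - l) (i * i - l * l) (j - l) (j * j - l * l) ≡ (i - l) * (j - l) * (j - i)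
    det₂-vandermonde = identity
      where
      identity : ∀ i j l →
        (i - l) * (j * j - l * l) - (i * i - l * l) * (j - l) ≡ (i - l) * (j - l) * (j - i)
      identity = solve-∀

    det₃-vandermonde : ∀ i j k l →
      det₃ (i - l) (i * i - l * l) (i * i * i - l * l * l)
           (j - l) (j * j - l * l) (j * j * j - l * l * l)
           (k - l) (k * k - l * l) (k * k * k - l * l * l)
        ≡ (i - l) * (j - l) * (k - l) * (j - i) * (k - i) * (k - j)
    det₃-vandermonde = identity
      where
      identity : ∀ i j k l →
        let a₁ = i - l; a₂ = i * i - l * l; a₃ = i * i * i - l * l * l
            b₁ = j - l; b₂ = j * j - l * l; b₃ = j * j * j - l * l * l
            c₁ = k - l; c₂ = k * k - l * l; c₃ = k * k * k - l * l * l
        in a₁ * (b₂ * c₃ - b₃ * c₂) + a₂ * (b₃ * c₁ - b₁ * c₃) + a₃ * (b₁ * c₂ - b₂ * c₁)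
           ≡ (i - l) * (j - l) * (k - l) * (j - i) * (k - i) * (k - j)
      identity = solve-∀

    -- Cramer's rule without division: weighting the equations by the cofactors of the first vector
    -- eliminates the other one. A nonzero determinant then forces α = 0; `det₃-cramer` works in the
    -- same way.
    det₂-cramer : ∀ α β a₁ a₂ b₁ b₂ →
      α * a₁ + β * b₁ ≡ + 0 → α * a₂ + β * b₂ ≡ + 0 → α * det₂ a₁ a₂ b₁ b₂ ≡ + 0
    det₂-cramer α β a₁ a₂ b₁ b₂ e₁ e₂ =
      trans (identity α β a₁ a₂ b₁ b₂) (vanishing b₂ b₁ e₁ e₂)
      where
      identity : ∀ α β a₁ a₂ b₁ b₂ →
        α * (a₁ * b₂ - a₂ * b₁) ≡ (α * a₁ + β * b₁) * b₂ - (α * a₂ + β * b₂) * b₁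
      identity = solve-∀
      vanishing : ∀ {x y} m n → x ≡ + 0 → y ≡ + 0 → x * m - y * n ≡ + 0
      vanishing m n refl refl = zeros m n
        where
        zeros : ∀ m n → + 0 * m - + 0 * n ≡ + 0
        zeros = solve-∀

    det₃-cramer : ∀ α β γ a₁ a₂ a₃ b₁ b₂ b₃ c₁ c₂ c₃ →
      α * a₁ + β * b₁ + γ * c₁ ≡ + 0 → α * a₂ + β * b₂ + γ * c₂ ≡ + 0 → α * a₃ + β * b₃ + γ * c₃ ≡ + 0 →
      α * det₃ a₁ a₂ a₃ b₁ b₂ b₃ c₁ c₂ c₃ ≡ + 0
    det₃-cramer α β γ a₁ a₂ a₃ b₁ b₂ b₃ c₁ c₂ c₃ e₁ e₂ e₃ =
      trans (identity α β γ a₁ a₂ a₃ b₁ b₂ b₃ c₁ c₂ c₃)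
        (vanishing (b₂ * c₃ - b₃ * c₂) (b₃ * c₁ - b₁ * c₃) (b₁ * c₂ - b₂ * c₁) e₁ e₂ e₃)
      where
      identity : ∀ α β γ a₁ a₂ a₃ b₁ b₂ b₃ c₁ c₂ c₃ →
        α * (a₁ * (b₂ * c₃ - b₃ * c₂) + a₂ * (b₃ * c₁ - b₁ * c₃) + a₃ * (b₁ * c₂ - b₂ * c₁))
          ≡ (α * a₁ + β * b₁ + γ * c₁) * (b₂ * c₃ - b₃ * c₂)
          + (α * a₂ + β * b₂ + γ * c₂) * (b₃ * c₁ - b₁ * c₃)
          + (α * a₃ + β * b₃ + γ * c₃) * (b₁ * c₂ - b₂ * c₁)
      identity = solve-∀
      vanishing : ∀ {x y z} l m n → x ≡ + 0 → y ≡ + 0 → z ≡ + 0 → x * l + y * m + z * n ≡ + 0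
      vanishing l m n refl refl refl = zeros l m n
        where
        zeros : ∀ l m n → + 0 * l + + 0 * m + + 0 * n ≡ + 0
        zeros = solve-∀

  *-zero-cancelʳ : ∀ {a b} → b ≢ + 0 → a * b ≡ + 0 → a ≡ + 0
  *-zero-cancelʳ {a} b≢0 ab≡0 = [ (λ a≡0 → a≡0) , (λ b≡0 → contradiction b≡0 b≢0) ]′ (ℤ.i*j≡0⇒i≡0∨j≡0 a ab≡0)

  -- Arithmetic modulo p and the moment curve.

  module _ {p : ℕ} (p-prime : Prime p) where

    -- Invertibility modulo `p`, phrased by absolute values so that Euclid's lemma for naturals
    -- applies.
    Unit : ℤ → Set
    Unit z = ¬ (p ℕ.∣ ∣ z ∣)

    unit-* : ∀ {a b} → Unit a → Unit b → Unit (a * b)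
    unit-* {a} {b} a-unit b-unit p∣ab =
      [ a-unit , b-unit ]′ (euclidsLemma ∣ a ∣ ∣ b ∣ p-prime (subst (p ℕ.∣_) (ℤ.abs-* a b) p∣ab))

    -- The difference is nonzero with absolute value below `p`, so it is no multiple of `p`.
    unit-difference : ∀ {i j} → i ℕ.< p → j ℕ.< p → i ≢ j → Unit (+ i - + j)
    unit-difference {i} {j} i<p j<p i≢j p∣ =
      ℕ.>⇒∤ {{ℕ.≢-nonZero λ ∣i-j∣≡0 → i≢j (ℤ.+-injective (ℤ.i-j≡0⇒i≡j (+ i) (+ j) (ℤ.∣i∣≡0⇒i≡0 ∣i-j∣≡0)))}}
        (subst (ℕ._< p) (cong ∣_∣ (sym (ℤ.[+m]-[+n]≡m⊖n i j)))
          (ℕ.≤-<-trans (ℤ.∣m⊝n∣≤m⊔n i j) (ℕ.⊔-lub i<p j<p))) p∣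

    infix 4 _≈_
    -- Congruence modulo `p` with an explicit quotient, so that compatibility with the ring
    -- operations becomes a matter of polynomial identities.
    record _≈_ (a b : ℤ) : Set where
      constructor congruent
      field
        witness : ℤ
        proof   : a ≡ b + + p * witness

    ≈-refl : ∀ {a} → a ≈ a
    ≈-refl {a} = congruent (+ 0) (sym (trans (cong (λ z → a + z) (ℤ.*-zeroʳ (+ p))) (ℤ.+-identityʳ a)))

    ≈-+ : ∀ {a a′ b b′} → a ≈ a′ → b ≈ b′ → a + b ≈ a′ + b′
    ≈-+ {a′ = a} {b′ = b} (congruent v refl) (congruent w refl) = congruent (v + w) (identity (+ p) a b v w)
      where
      identity : ∀ p a b v w → (a + p * v) + (b + p * w) ≡ a + b + p * (v + w)
      identity = solve-∀

    ≈-- : ∀ {a a′ b b′} → a ≈ a′ → b ≈ b′ → a - b ≈ a′ - b′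
    ≈-- {a′ = a} {b′ = b} (congruent v refl) (congruent w refl) = congruent (v - w) (identity (+ p) a b v w)
      where
      identity : ∀ p a b v w → (a + p * v) - (b + p * w) ≡ a - b + p * (v - w)
      identity = solve-∀

    ≈-* : ∀ {a a′ b b′} → a ≈ a′ → b ≈ b′ → a * b ≈ a′ * b′
    ≈-* {a′ = a} {b′ = b} (congruent v refl) (congruent w refl) =
      congruent (a * w + v * b + + p * v * w) (identity (+ p) a b v w)
      where
      identity : ∀ p a b v w → (a + p * v) * (b + p * w) ≡ a * b + p * (a * w + v * b + p * v * w)
      identity = solve-∀

    -- The bridge from residues to ℤ: a determinant that is nonzero modulo `p` is nonzero.
    unit≈⇒≢0 : ∀ {a u} → a ≈ u → Unit u → a ≢ + 0
    unit≈⇒≢0 {a} {u} (congruent w eq) u-unit a≡0 = u-unit (subst (p ℕ.∣_) (sym ∣u∣≡) (ℕ.m∣m*n ∣ w ∣))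
      where
      open ≡-Reasoning
      cancel : ∀ a b → a ≡ (a + b) - b
      cancel = solve-∀
      ∣u∣≡ : ∣ u ∣ ≡ p ℕ.* ∣ w ∣
      ∣u∣≡ = begin
        ∣ u ∣                           ≡⟨ cong ∣_∣ (cancel u (+ p * w)) ⟩
        ∣ (u + + p * w) - + p * w ∣     ≡⟨ cong (λ z → ∣ z - + p * w ∣) (trans (sym eq) a≡0) ⟩
        ∣ + 0 - + p * w ∣               ≡⟨ cong ∣_∣ (ℤ.+-identityˡ (- (+ p * w))) ⟩
        ∣ - (+ p * w) ∣                 ≡⟨ ℤ.∣-i∣≡∣i∣ (+ p * w) ⟩
        ∣ + p * w ∣                     ≡⟨ ℤ.abs-* (+ p) w ⟩
        p ℕ.* ∣ w ∣ ∎

    instance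
      p≢0 : NonZero p
      p≢0 = prime⇒nonZero p-prime

    y-coord : ℕ → ℤ
    y-coord i = + (i ℕ.* i % p)

    -- The height enters only through a multiple of `p`, so modulo `p` every point of track `i` lies
    -- over the same point of the moment curve.
    z-coord : ℕ → ℕ → ℤ
    z-coord i h = + (p ℕ.* h ℕ.+ i ℕ.* i ℕ.* i % p)

    point : ℕ → ℕ → Point
    point i h = + i , y-coord i , z-coord i h

    %-≈ : ∀ m → + (m % p) ≈ + m
    %-≈ m = congruent (- + (m / p)) (begin
      + (m % p)                                             ≡⟨ cancel (+ (m % p)) (+ p) (+ (m / p)) ⟩
      (+ (m % p) + + (m / p) * + p) + + p * - + (m / p)     ≡⟨ cong (λ z → (+ (m % p) + z) + + p * - + (m / p)) (sym (ℤ.pos-* (m / p) p)) ⟩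
      + (m % p ℕ.+ m / p ℕ.* p) + + p * - + (m / p)         ≡⟨ cong (λ z → + z + + p * - + (m / p)) (sym (m≡m%n+[m/n]*n m p)) ⟩
      + m + + p * - + (m / p) ∎)
      where
      open ≡-Reasoning
      cancel : ∀ r p q → r ≡ (r + q * p) + p * - q
      cancel = solve-∀

    y-coord-≈ : ∀ i → y-coord i ≈ + i * + i
    y-coord-≈ i = subst (y-coord i ≈_) (ℤ.pos-* i i) (%-≈ (i ℕ.* i))

    z-coord-≈ : ∀ i h → z-coord i h ≈ + i * + i * + i
    z-coord-≈ i h = subst₂ _≈_ (cong (_+ + (i ℕ.* i ℕ.* i % p)) (sym (ℤ.pos-* p h)))
      (trans (ℤ.+-identityˡ _) (trans (ℤ.pos-* (i ℕ.* i) i) (cong (_* + i) (ℤ.pos-* i i))))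
      (≈-+ {b = + (i ℕ.* i ℕ.* i % p)} (congruent {+ p * + h} {+ 0} (+ h) (sym (ℤ.+-identityˡ _))) (%-≈ (i ℕ.* i ℕ.* i)))

    opaque
      unfolding det₂ det₃

      det₂-≈ : ∀ {a₁ a₂ b₁ b₂ a₁′ a₂′ b₁′ b₂′} → a₁ ≈ a₁′ → a₂ ≈ a₂′ → b₁ ≈ b₁′ → b₂ ≈ b₂′ →
        det₂ a₁ a₂ b₁ b₂ ≈ det₂ a₁′ a₂′ b₁′ b₂′
      det₂-≈ a₁ a₂ b₁ b₂ = ≈-- (≈-* a₁ b₂) (≈-* a₂ b₁)

    opaque
      unfolding det₂ det₃

      det₃-≈ : ∀ {a₁ a₂ a₃ b₁ b₂ b₃ c₁ c₂ c₃ a₁′ a₂′ a₃′ b₁′ b₂′ b₃′ c₁′ c₂′ c₃′} →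
        a₁ ≈ a₁′ → a₂ ≈ a₂′ → a₃ ≈ a₃′ → b₁ ≈ b₁′ → b₂ ≈ b₂′ → b₃ ≈ b₃′ → c₁ ≈ c₁′ → c₂ ≈ c₂′ → c₃ ≈ c₃′ →
        det₃ a₁ a₂ a₃ b₁ b₂ b₃ c₁ c₂ c₃ ≈ det₃ a₁′ a₂′ a₃′ b₁′ b₂′ b₃′ c₁′ c₂′ c₃′
      det₃-≈ a₁ a₂ a₃ b₁ b₂ b₃ c₁ c₂ c₃ =
        ≈-+ (≈-+ (≈-* a₁ (≈-- (≈-* b₂ c₃) (≈-* b₃ c₂))) (≈-* a₂ (≈-- (≈-* b₃ c₁) (≈-* b₁ c₃))))
            (≈-* a₃ (≈-- (≈-* b₁ c₂) (≈-* b₂ c₁)))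

    -- Track lines are vertical, so it suffices to look at their feet in the xy-plane. Modulo `p`
    -- the determinant is a Vandermonde product of three differences of distinct labels.
    noncollinear : ∀ {i j l} → i ℕ.< p → j ℕ.< p → l ℕ.< p → i ≢ j → i ≢ l → j ≢ l →
      det₂ (+ i - + l) (y-coord i - y-coord l) (+ j - + l) (y-coord j - y-coord l) ≢ + 0
    noncollinear {i} {j} {l} i< j< l< i≢j i≢l j≢l =
      unit≈⇒≢0
        (det₂-≈ (≈-refl {+ i - + l}) (≈-- (y-coord-≈ i) (y-coord-≈ l)) (≈-refl {+ j - + l}) (≈-- (y-coord-≈ j) (y-coord-≈ l)))
        (subst Unit (sym (det₂-vandermonde (+ i) (+ j) (+ l)))
          (unit-* {(+ i - + l) * (+ j - + l)} (unit-* {+ i - + l} (unit-difference i< l< i≢l) (unit-difference j< l< j≢l))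
            (unit-difference j< i< (≢-sym i≢j))))

    -- Modulo `p` the heights disappear and a Vandermonde product of six units remains, whichever
    -- points are chosen on the four tracks.
    noncoplanar : ∀ {i j k l} a b c d → i ℕ.< p → j ℕ.< p → k ℕ.< p → l ℕ.< p →
      i ≢ j → i ≢ k → i ≢ l → j ≢ k → j ≢ l → k ≢ l →
      det₃ (+ i - + l) (y-coord i - y-coord l) (z-coord i a - z-coord l d)
           (+ j - + l) (y-coord j - y-coord l) (z-coord j b - z-coord l d)
           (+ k - + l) (y-coord k - y-coord l) (z-coord k c - z-coord l d) ≢ + 0
    noncoplanar {i} {j} {k} {l} a b c d i< j< k< l< i≢j i≢k i≢l j≢k j≢l k≢l =
      unit≈⇒≢0
        (det₃-≈ (≈-refl {il}) (≈-- (y-coord-≈ i) (y-coord-≈ l)) (≈-- (z-coord-≈ i a) (z-coord-≈ l d))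
                (≈-refl {jl}) (≈-- (y-coord-≈ j) (y-coord-≈ l)) (≈-- (z-coord-≈ j b) (z-coord-≈ l d))
                (≈-refl {kl}) (≈-- (y-coord-≈ k) (y-coord-≈ l)) (≈-- (z-coord-≈ k c) (z-coord-≈ l d)))
        (subst Unit (sym (det₃-vandermonde (+ i) (+ j) (+ k) (+ l)))
          (unit-* {il * jl * kl * ji * ki} (unit-* {il * jl * kl * ji} (unit-* {il * jl * kl} (unit-* {il * jl} (unit-* {il}
            (unit-difference i< l< i≢l) (unit-difference j< l< j≢l)) (unit-difference k< l< k≢l))
            (unit-difference j< i< (≢-sym i≢j))) (unit-difference k< i< (≢-sym i≢k))) (unit-difference k< j< (≢-sym j≢k))))
      where
      il = + i - + l
      jl = + j - + l
      kl = + k - + l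
      ji = + j - + i
      ki = + k - + i

  -- The embedding of ℤ into ℚ.

  toℚᵘ-ℤ→ℚ : ∀ a → toℚᵘ (ℤ→ℚ a) ℚᵘ.≃ mkℚᵘ a 0
  toℚᵘ-ℤ→ℚ a = ℚ.toℚᵘ-fromℚᵘ (mkℚᵘ a 0)

  ℤ→ℚ-injective : ∀ {a b} → ℤ→ℚ a ≡ ℤ→ℚ b → a ≡ b
  ℤ→ℚ-injective {a} {b} eq with ℚᵘ.≃-trans (ℚᵘ.≃-sym (toℚᵘ-ℤ→ℚ a)) (ℚᵘ.≃-trans (ℚ.toℚᵘ-cong eq) (toℚᵘ-ℤ→ℚ b))
  ... | *≡* a1≡b1 = trans (sym (ℤ.*-identityʳ a)) (trans a1≡b1 (ℤ.*-identityʳ b))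

  ℤ→ℚ-+ : ∀ a b → ℤ→ℚ (a + b) ≡ ℤ→ℚ a ℚ.+ ℤ→ℚ b
  ℤ→ℚ-+ a b = ℚ.toℚᵘ-injective (begin
    toℚᵘ (ℤ→ℚ (a + b))                    ≈⟨ toℚᵘ-ℤ→ℚ (a + b) ⟩
    mkℚᵘ (a + b) 0                        ≈⟨ *≡* (identity a b) ⟩
    mkℚᵘ a 0 ℚᵘ.+ mkℚᵘ b 0                ≈⟨ ℚᵘ.+-cong (ℚᵘ.≃-sym (toℚᵘ-ℤ→ℚ a)) (ℚᵘ.≃-sym (toℚᵘ-ℤ→ℚ b)) ⟩
    toℚᵘ (ℤ→ℚ a) ℚᵘ.+ toℚᵘ (ℤ→ℚ b)        ≈⟨ ℚᵘ.≃-sym (ℚ.toℚᵘ-homo-+ (ℤ→ℚ a) (ℤ→ℚ b)) ⟩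
    toℚᵘ (ℤ→ℚ a ℚ.+ ℤ→ℚ b) ∎)
    where
    open ℚᵘ.≃-Reasoning
    identity : ∀ a b → (a + b) * + 1 ≡ (a * + 1 + b * + 1) * + 1
    identity = solve-∀

  ℤ→ℚ-* : ∀ a b → ℤ→ℚ (a * b) ≡ ℤ→ℚ a ℚ.* ℤ→ℚ b
  ℤ→ℚ-* a b = ℚ.toℚᵘ-injective (begin
    toℚᵘ (ℤ→ℚ (a * b))                    ≈⟨ toℚᵘ-ℤ→ℚ (a * b) ⟩
    mkℚᵘ a 0 ℚᵘ.* mkℚᵘ b 0                ≈⟨ ℚᵘ.*-cong (ℚᵘ.≃-sym (toℚᵘ-ℤ→ℚ a)) (ℚᵘ.≃-sym (toℚᵘ-ℤ→ℚ b)) ⟩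
    toℚᵘ (ℤ→ℚ a) ℚᵘ.* toℚᵘ (ℤ→ℚ b)        ≈⟨ ℚᵘ.≃-sym (ℚ.toℚᵘ-homo-* (ℤ→ℚ a) (ℤ→ℚ b)) ⟩
    toℚᵘ (ℤ→ℚ a ℚ.* ℤ→ℚ b) ∎)
    where open ℚᵘ.≃-Reasoning

  ℤ→ℚ-neg : ∀ a → ℤ→ℚ (- a) ≡ ℚ.- ℤ→ℚ a
  ℤ→ℚ-neg a = ℚ.toℚᵘ-injective (begin
    toℚᵘ (ℤ→ℚ (- a))      ≈⟨ toℚᵘ-ℤ→ℚ (- a) ⟩
    ℚᵘ.- mkℚᵘ a 0         ≈⟨ ℚᵘ.-‿cong (ℚᵘ.≃-sym (toℚᵘ-ℤ→ℚ a)) ⟩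
    ℚᵘ.- toℚᵘ (ℤ→ℚ a)     ≈⟨ ℚᵘ.≃-sym (ℚ.toℚᵘ-homo‿- (ℤ→ℚ a)) ⟩
    toℚᵘ (ℚ.- ℤ→ℚ a) ∎)
    where open ℚᵘ.≃-Reasoning

  ℤ→ℚ-- : ∀ a b → ℤ→ℚ (a - b) ≡ ℤ→ℚ a ℚ.- ℤ→ℚ b
  ℤ→ℚ-- a b = trans (ℤ→ℚ-+ a (- b)) (cong (ℤ→ℚ a ℚ.+_) (ℤ→ℚ-neg b))

  ℤ→ℚ-cancel-≤ : ∀ {a b} → ℤ→ℚ a ℚ.≤ ℤ→ℚ b → a ℤ.≤ b
  ℤ→ℚ-cancel-≤ {a} {b} a≤b
    with ℚᵘ.≤-trans (ℚᵘ.≤-reflexive (ℚᵘ.≃-sym (toℚᵘ-ℤ→ℚ a))) (ℚᵘ.≤-trans (ℚ.toℚᵘ-mono-≤ a≤b) (ℚᵘ.≤-reflexive (toℚᵘ-ℤ→ℚ b)))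
  ... | *≤* a1≤b1 = subst₂ ℤ._≤_ (ℤ.*-identityʳ a) (ℤ.*-identityʳ b) a1≤b1

  ℤ→ℚ-mono-≤ : ∀ {a b} → a ℤ.≤ b → ℤ→ℚ a ℚ.≤ ℤ→ℚ b
  ℤ→ℚ-mono-≤ {a} {b} a≤b = ℚ.toℚᵘ-cancel-≤ (begin
    toℚᵘ (ℤ→ℚ a)   ≃⟨ toℚᵘ-ℤ→ℚ a ⟩
    mkℚᵘ a 0       ≤⟨ *≤* (subst₂ ℤ._≤_ (sym (ℤ.*-identityʳ a)) (sym (ℤ.*-identityʳ b)) a≤b) ⟩
    mkℚᵘ b 0       ≃⟨ ℚᵘ.≃-sym (toℚᵘ-ℤ→ℚ b) ⟩
    toℚᵘ (ℤ→ℚ b) ∎)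
    where open ℚᵘ.≤-Reasoning

  *-denominator : ∀ q → q ℚ.* ℕ→ℚ (ℚ.↧ₙ q) ≡ ℤ→ℚ (ℚ.↥ q)
  *-denominator q@(mkℚ m d-1 _) = ℚ.toℚᵘ-injective (begin
    toℚᵘ (q ℚ.* ℕ→ℚ d)                 ≈⟨ ℚ.toℚᵘ-homo-* q (ℕ→ℚ d) ⟩
    mkℚᵘ m d-1 ℚᵘ.* toℚᵘ (ℕ→ℚ d)       ≈⟨ ℚᵘ.*-congˡ {mkℚᵘ m d-1} (toℚᵘ-ℤ→ℚ (+ d)) ⟩
    mkℚᵘ m d-1 ℚᵘ.* mkℚᵘ (+ d) 0       ≈⟨ *≡* (trans (ℤ.*-identityʳ (m * + d)) (cong (λ k → m * + k) (sym (ℕ.*-identityʳ d)))) ⟩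
    mkℚᵘ m 0                           ≈⟨ ℚᵘ.≃-sym (toℚᵘ-ℤ→ℚ m) ⟩
    toℚᵘ (ℤ→ℚ m) ∎)
    where
    open ℚᵘ.≃-Reasoning
    d = suc d-1

  instance
    ℕ→ℚ-pos : ∀ {d} .{{_ : NonZero d}} → ℚ.Positive (ℕ→ℚ d)
    ℕ→ℚ-pos {suc d} = ℚ.normalize-pos (suc d) 1

  -- Convex combinations with natural weights, so that dependencies between lattice points live over ℤ.
  record Weighted (α β : ℕ) (x : ℚ) (a b : ℤ) : Set where
    constructor weighted
    field
      equation : x ℚ.* ℕ→ℚ (α ℕ.+ β) ≡ ℤ→ℚ (+ α * a + + β * b)

  record Between (q : PointQ) (a b : Point) : Set where
    constructor between
    field
      α β   : ℕ
      total : NonZero (α ℕ.+ β)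
      on-x  : Weighted α β (proj₁ q) (proj₁ a) (proj₁ b)
      on-y  : Weighted α β (proj₁ (proj₂ q)) (proj₁ (proj₂ a)) (proj₁ (proj₂ b))
      on-z  : Weighted α β (proj₂ (proj₂ q)) (proj₂ (proj₂ a)) (proj₂ (proj₂ b))

  weighted-swap : ∀ α β {x a b} → Weighted α β x a b → Weighted β α x b a
  weighted-swap α β {x} {a} {b} (weighted w) = weighted (
    subst₂ (λ k z → x ℚ.* ℕ→ℚ k ≡ ℤ→ℚ z) (ℕ.+-comm α β) (ℤ.+-comm (+ α * a) (+ β * b)) w)

  between-swap : ∀ {q a b} → Between q a b → Between q b a
  between-swap (between α β total wx wy wz) = between β α (subst NonZero (ℕ.+-comm α β) total)
    (weighted-swap α β wx) (weighted-swap α β wy) (weighted-swap α β wz)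

  lerp1-weighted : ∀ k j {q} → q ℚ.* ℕ→ℚ (j ℕ.+ k) ≡ ℕ→ℚ k → ∀ a b →
    Weighted j k (lerp1 (ℤ→ℚ a) (ℤ→ℚ b) q) a b
  lerp1-weighted k j {q} qd≡k a b = weighted (begin
    (ℤ→ℚ a ℚ.+ q ℚ.* (ℤ→ℚ b ℚ.- ℤ→ℚ a)) ℚ.* d
      ≡⟨ ℚ.*-distribʳ-+ d (ℤ→ℚ a) (q ℚ.* (ℤ→ℚ b ℚ.- ℤ→ℚ a)) ⟩
    ℤ→ℚ a ℚ.* d ℚ.+ q ℚ.* (ℤ→ℚ b ℚ.- ℤ→ℚ a) ℚ.* d
      ≡⟨ cong (λ z → ℤ→ℚ a ℚ.* d ℚ.+ z) (trans (ℚ.*-assoc q _ d) (trans (cong (q ℚ.*_) (ℚ.*-comm _ d)) (sym (ℚ.*-assoc q d _)))) ⟩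
    ℤ→ℚ a ℚ.* d ℚ.+ q ℚ.* d ℚ.* (ℤ→ℚ b ℚ.- ℤ→ℚ a)
      ≡⟨ cong₂ (λ z w → ℤ→ℚ a ℚ.* d ℚ.+ z ℚ.* w) qd≡k (sym (ℤ→ℚ-- b a)) ⟩
    ℤ→ℚ a ℚ.* d ℚ.+ ℕ→ℚ k ℚ.* ℤ→ℚ (b - a)
      ≡⟨ cong₂ ℚ._+_ (sym (ℤ→ℚ-* a (+ (j ℕ.+ k)))) (sym (ℤ→ℚ-* (+ k) (b - a))) ⟩
    ℤ→ℚ (a * + (j ℕ.+ k)) ℚ.+ ℤ→ℚ (+ k * (b - a))
      ≡⟨ sym (ℤ→ℚ-+ (a * + (j ℕ.+ k)) (+ k * (b - a))) ⟩
    ℤ→ℚ (a * + (j ℕ.+ k) + + k * (b - a))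
      ≡⟨ cong ℤ→ℚ (identity a b (+ j) (+ k)) ⟩
    ℤ→ℚ (+ j * a + + k * b) ∎)
    where
    open ≡-Reasoning
    d = ℕ→ℚ (j ℕ.+ k)
    identity : ∀ a b j k → a * (j + k) + k * (b - a) ≡ j * a + k * b
    identity = solve-∀

  -- For the parameter t = k/d the weights are d - k and k; the bounds 0 ≤ t ≤ 1 make both of them
  -- natural numbers.
  onSeg⇒between : ∀ {q a b} → OnSeg q a b → Between q a b
  onSeg⇒between {q} {a₁ , a₂ , a₃} {b₁ , b₂ , b₃} (t , 0≤t , t≤1 , refl) =
    between j k (subst NonZero (sym j+k≡d) _)
      (lerp1-weighted k j {t} td≡k a₁ b₁) (lerp1-weighted k j {t} td≡k a₂ b₂) (lerp1-weighted k j {t} td≡k a₃ b₃)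
    where
    d = ℚ.↧ₙ t
    k = ∣ ℚ.↥ t ∣
    j = d ℕ.∸ k
    ↥t≡k : + k ≡ ℚ.↥ t
    ↥t≡k = ℤ.0≤i⇒+∣i∣≡i (subst (+ 0 ℤ.≤_) (ℤ.*-identityʳ (ℚ.↥ t)) (ℚ.drop-*≤* 0≤t))
    k≤d : k ℕ.≤ d
    k≤d = ℤ.drop‿+≤+ (subst₂ ℤ._≤_ (trans (ℤ.*-identityʳ (ℚ.↥ t)) (sym ↥t≡k)) (ℤ.*-identityˡ (+ d)) (ℚ.drop-*≤* t≤1))
    j+k≡d : j ℕ.+ k ≡ d
    j+k≡d = ℕ.m∸n+n≡m k≤d
    td≡k : t ℚ.* ℕ→ℚ (j ℕ.+ k) ≡ ℕ→ℚ k
    td≡k = trans (cong (λ n → t ℚ.* ℕ→ℚ n) j+k≡d) (trans (*-denominator t) (cong ℤ→ℚ (sym ↥t≡k)))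

  *-cancelʳ-ℕ→ℚ : ∀ {x y} d .{{_ : NonZero d}} → x ℚ.* ℕ→ℚ d ≡ y ℚ.* ℕ→ℚ d → x ≡ y
  *-cancelʳ-ℕ→ℚ d eq = ℚ.≤-antisym (ℚ.*-cancelʳ-≤-pos (ℕ→ℚ d) (ℚ.≤-reflexive eq)) (ℚ.*-cancelʳ-≤-pos (ℕ→ℚ d) (ℚ.≤-reflexive (sym eq)))

  weighted-endpoint : ∀ α {x a b} .{{_ : NonZero (α ℕ.+ 0)}} → Weighted α 0 x a b → x ≡ ℤ→ℚ a
  weighted-endpoint α {x} {a} {b} (weighted w) = *-cancelʳ-ℕ→ℚ (α ℕ.+ 0) (trans w (begin
    ℤ→ℚ (+ α * a + + 0 * b)    ≡⟨ cong ℤ→ℚ (identity (+ α) a b) ⟩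
    ℤ→ℚ (a * + α)              ≡⟨ cong (λ n → ℤ→ℚ (a * + n)) (sym (ℕ.+-identityʳ α)) ⟩
    ℤ→ℚ (a * + (α ℕ.+ 0))      ≡⟨ ℤ→ℚ-* a (+ (α ℕ.+ 0)) ⟩
    ℤ→ℚ a ℚ.* ℕ→ℚ (α ℕ.+ 0) ∎))
    where
    open ≡-Reasoning
    identity : ∀ α a b → α * a + + 0 * b ≡ a * α
    identity = solve-∀

  between-startpoint : ∀ {q a b} (B : Between q a b) → Between.β B ≡ 0 → q ≡ embed a
  between-startpoint (between α .0 total wx wy wz) refl = cong₂ _,_ (weighted-endpoint α {{total}} wx)
    (cong₂ _,_ (weighted-endpoint α {{total}} wy) (weighted-endpoint α {{total}} wz))

  between-endpoint : ∀ {q a b} (B : Between q a b) → Between.α B ≡ 0 → q ≡ embed b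
  between-endpoint B = between-startpoint (between-swap B)

  -- Both sides equal `x` times the two total weights. The unknown rational coordinate drops out,
  -- leaving an equation between integers.
  weighted-meet : ∀ α β γ δ {x a b c d} → Weighted α β x a b → Weighted γ δ x c d →
    (+ α * a + + β * b) * + (γ ℕ.+ δ) ≡ (+ γ * c + + δ * d) * + (α ℕ.+ β)
  weighted-meet α β γ δ {x} {a} {b} {c} {d} (weighted w) (weighted w′) = ℤ→ℚ-injective (begin
    ℤ→ℚ ((+ α * a + + β * b) * + (γ ℕ.+ δ))        ≡⟨ ℤ→ℚ-* (+ α * a + + β * b) (+ (γ ℕ.+ δ)) ⟩
    ℤ→ℚ (+ α * a + + β * b) ℚ.* s′                 ≡⟨ cong (ℚ._* s′) (sym w) ⟩
    x ℚ.* s ℚ.* s′                                 ≡⟨ trans (ℚ.*-assoc x s s′) (trans (cong (x ℚ.*_) (ℚ.*-comm s s′)) (sym (ℚ.*-assoc x s′ s))) ⟩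
    x ℚ.* s′ ℚ.* s                                 ≡⟨ cong (ℚ._* s) w′ ⟩
    ℤ→ℚ (+ γ * c + + δ * d) ℚ.* s                  ≡⟨ sym (ℤ→ℚ-* (+ γ * c + + δ * d) (+ (α ℕ.+ β))) ⟩
    ℤ→ℚ ((+ γ * c + + δ * d) * + (α ℕ.+ β)) ∎)
    where
    open ≡-Reasoning
    s = ℕ→ℚ (α ℕ.+ β)
    s′ = ℕ→ℚ (γ ℕ.+ δ)

  weighted-at : ∀ α β x {a b} → Weighted α β (ℤ→ℚ x) a b → + α * a + + β * b ≡ x * + (α ℕ.+ β)
  weighted-at α β x (weighted w) = ℤ→ℚ-injective (trans (sym w) (sym (ℤ→ℚ-* x (+ (α ℕ.+ β)))))

  -- Integer dependencies forced by a common point.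

  nonZero-sum⇒⊥ : ∀ {m n} → NonZero (m ℕ.+ n) → m ≡ 0 → n ≡ 0 → ⊥
  nonZero-sum⇒⊥ m+n≢0 refl refl = ℕ.≢-nonZero⁻¹ 0 {{m+n≢0}} refl

  difference-zero : ∀ a b → a ≡ b → a - b ≡ + 0
  difference-zero a b = ℤ.i≡j⇒i-j≡0

  weight-zero : ∀ m n .{{_ : NonZero n}} → + m * + n ≡ + 0 → m ≡ 0
  weight-zero m n eq = ℤ.+-injective (*-zero-cancelʳ (λ n≡0 → ℕ.≢-nonZero⁻¹ n (ℤ.+-injective n≡0)) eq)

  -- Both combinations have total weight (α+β)(γ+δ), so `d` may be taken as origin: the affine
  -- relation becomes a linear dependency among three difference vectors, as Cramer's rule requires.
  shift₄ : ∀ α β γ δ a b c d → (α * a + β * b) * (γ + δ) ≡ (γ * c + δ * d) * (α + β) →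
    α * (γ + δ) * (a - d) + β * (γ + δ) * (b - d) + (- (γ * (α + β))) * (c - d) ≡ + 0
  shift₄ α β γ δ a b c d eq = trans (identity α β γ δ a b c d) (difference-zero ((α * a + β * b) * (γ + δ)) ((γ * c + δ * d) * (α + β)) eq)
    where
    identity : ∀ α β γ δ a b c d →
      α * (γ + δ) * (a - d) + β * (γ + δ) * (b - d) + (- (γ * (α + β))) * (c - d)
        ≡ (α * a + β * b) * (γ + δ) - (γ * c + δ * d) * (α + β)
    identity = solve-∀

  shift₃ : ∀ α β γ δ a b c → (α * a + β * b) * (γ + δ) ≡ (γ * a + δ * c) * (α + β) →
    β * (γ + δ) * (b - a) + (- (δ * (α + β))) * (c - a) ≡ + 0
  shift₃ α β γ δ a b c eq = trans (identity α β γ δ a b c) (difference-zero ((α * a + β * b) * (γ + δ)) ((γ * a + δ * c) * (α + β)) eq)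
    where
    identity : ∀ α β γ δ a b c → β * (γ + δ) * (b - a) + (- (δ * (α + β))) * (c - a)
      ≡ (α * a + β * b) * (γ + δ) - (γ * a + δ * c) * (α + β)
    identity = solve-∀

  shift₂ : ∀ α β x a b → α * a + β * b ≡ x * (α + β) → α * (a - x) + β * (b - x) ≡ + 0
  shift₂ α β x a b eq = trans (identity α β x a b) (difference-zero (α * a + β * b) (x * (α + β)) eq)
    where
    identity : ∀ α β x a b → α * (a - x) + β * (b - x) ≡ (α * a + β * b) - x * (α + β)
    identity = solve-∀

  -- For two segments between the same two track lines, the x-coordinate alone shows that the common
  -- point divides both in the same ratio.
  parallel-weights : ∀ α β γ δ i j → i ≢ j →
    (α * i + β * j) * (γ + δ) ≡ (γ * i + δ * j) * (α + β) → δ * (α + β) - β * (γ + δ) ≡ + 0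
  parallel-weights α β γ δ i j i≢j eq =
    *-zero-cancelʳ (λ i-j≡0 → i≢j (ℤ.i-j≡0⇒i≡j i j i-j≡0)) (trans (identity α β γ δ i j) (difference-zero ((α * i + β * j) * (γ + δ)) ((γ * i + δ * j) * (α + β)) eq))
    where
    identity : ∀ α β γ δ i j → (δ * (α + β) - β * (γ + δ)) * (i - j)
      ≡ (α * i + β * j) * (γ + δ) - (γ * i + δ * j) * (α + β)
    identity = solve-∀

  -- Once the ratios agree, the offsets `r` and `t` of the two tracks cancel, and the heights can be
  -- compared with the same weights α and β on both segments.
  parallel-heights : ∀ p r t α β γ δ a b c d → δ * (α + β) - β * (γ + δ) ≡ + 0 →
    (α * (p * a + r) + β * (p * b + t)) * (γ + δ) ≡ (γ * (p * c + r) + δ * (p * d + t)) * (α + β) →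
    ((α * a + β * b) - (α * c + β * d)) * ((γ + δ) * p) ≡ + 0
  parallel-heights p r t α β γ δ a b c d e≡0 eq =
    trans (identity p r t α β γ δ a b c d)
      (vanishing ((p * d + t) - (p * c + r)) (difference-zero ((α * (p * a + r) + β * (p * b + t)) * (γ + δ)) ((γ * (p * c + r) + δ * (p * d + t)) * (α + β)) eq) e≡0)
    where
    identity : ∀ p r t α β γ δ a b c d →
      ((α * a + β * b) - (α * c + β * d)) * ((γ + δ) * p)
        ≡ ((α * (p * a + r) + β * (p * b + t)) * (γ + δ) - (γ * (p * c + r) + δ * (p * d + t)) * (α + β))
          + (δ * (α + β) - β * (γ + δ)) * ((p * d + t) - (p * c + r))
    identity = solve-∀
    vanishing : ∀ {x y} z → x ≡ + 0 → y ≡ + 0 → x + y * z ≡ + 0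
    vanishing z refl refl = zeros z
      where
      zeros : ∀ z → + 0 + + 0 * z ≡ + 0
      zeros = solve-∀

  equal-combinations : ∀ p r t α β γ δ a b c d i j .{{_ : NonZero p}} .{{_ : NonZero (γ ℕ.+ δ)}} → i ≢ j →
    (+ α * + i + + β * + j) * + (γ ℕ.+ δ) ≡ (+ γ * + i + + δ * + j) * + (α ℕ.+ β) →
    (+ α * + (p ℕ.* a ℕ.+ r) + + β * + (p ℕ.* b ℕ.+ t)) * + (γ ℕ.+ δ)
      ≡ (+ γ * + (p ℕ.* c ℕ.+ r) + + δ * + (p ℕ.* d ℕ.+ t)) * + (α ℕ.+ β) →
    α ℕ.* a ℕ.+ β ℕ.* b ≡ α ℕ.* c ℕ.+ β ℕ.* d
  equal-combinations p r t α β γ δ a b c d i j i≢j x-eq z-eq =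
    ℤ.+-injective (trans (pos-combination a b) (trans
      (ℤ.i-j≡0⇒i≡j (+ α * + a + + β * + b) (+ α * + c + + β * + d) difference≡0)
      (sym (pos-combination c d))))
    where
    pos-affine : ∀ m n → + (p ℕ.* m ℕ.+ n) ≡ + p * + m + + n
    pos-affine m n = cong (_+ + n) (ℤ.pos-* p m)

    pos-combination : ∀ m n → + (α ℕ.* m ℕ.+ β ℕ.* n) ≡ + α * + m + + β * + n
    pos-combination m n = cong₂ _+_ (ℤ.pos-* α m) (ℤ.pos-* β n)

    weights : + δ * (+ α + + β) - + β * (+ γ + + δ) ≡ + 0
    weights = parallel-weights (+ α) (+ β) (+ γ) (+ δ) (+ i) (+ j) (λ eq → i≢j (ℤ.+-injective eq)) x-eq

    z-eq′ : (+ α * (+ p * + a + + r) + + β * (+ p * + b + + t)) * + (γ ℕ.+ δ)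
          ≡ (+ γ * (+ p * + c + + r) + + δ * (+ p * + d + + t)) * + (α ℕ.+ β)
    z-eq′ = begin
      (+ α * (+ p * + a + + r) + + β * (+ p * + b + + t)) * + (γ ℕ.+ δ)
        ≡⟨ cong₂ (λ u v → (+ α * u + + β * v) * + (γ ℕ.+ δ)) (sym (pos-affine a r)) (sym (pos-affine b t)) ⟩
      (+ α * + (p ℕ.* a ℕ.+ r) + + β * + (p ℕ.* b ℕ.+ t)) * + (γ ℕ.+ δ)
        ≡⟨ z-eq ⟩
      (+ γ * + (p ℕ.* c ℕ.+ r) + + δ * + (p ℕ.* d ℕ.+ t)) * + (α ℕ.+ β)
        ≡⟨ cong₂ (λ u v → (+ γ * u + + δ * v) * + (α ℕ.+ β)) (pos-affine c r) (pos-affine d t) ⟩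
      (+ γ * (+ p * + c + + r) + + δ * (+ p * + d + + t)) * + (α ℕ.+ β) ∎
      where open ≡-Reasoning

    scale≢0 : + (γ ℕ.+ δ) * + p ≢ + 0
    scale≢0 eq = ℕ.≢-nonZero⁻¹ (γ ℕ.+ δ) (weight-zero (γ ℕ.+ δ) p eq)

    difference≡0 : (+ α * + a + + β * + b) - (+ α * + c + + β * + d) ≡ + 0
    difference≡0 = *-zero-cancelʳ {b = + (γ ℕ.+ δ) * + p} scale≢0
      (parallel-heights (+ p) (+ r) (+ t) (+ α) (+ β) (+ γ) (+ δ) (+ a) (+ b) (+ c) (+ d) weights z-eq′)

  -- Termwise inequalities with equal sums are equalities, and a positive weight can be cancelled
  -- from its term.
  monotone-combination : ∀ α β {a b c d} → a ℕ.≤ c → b ℕ.≤ d →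
    α ℕ.* a ℕ.+ β ℕ.* b ≡ α ℕ.* c ℕ.+ β ℕ.* d → (a ≡ c ⊎ α ≡ 0) × (b ≡ d ⊎ β ≡ 0)
  monotone-combination α β {a} {b} {c} {d} a≤c b≤d eq =
    cancel α (ℕ.≤-antisym (ℕ.*-monoʳ-≤ α a≤c)
      (ℕ.+-cancelʳ-≤ (β ℕ.* d) _ _ (ℕ.≤-trans (ℕ.≤-reflexive (sym eq)) (ℕ.+-monoʳ-≤ (α ℕ.* a) (ℕ.*-monoʳ-≤ β b≤d))))) ,
    cancel β (ℕ.≤-antisym (ℕ.*-monoʳ-≤ β b≤d)
      (ℕ.+-cancelˡ-≤ (α ℕ.* c) _ _ (ℕ.≤-trans (ℕ.≤-reflexive (sym eq)) (ℕ.+-monoˡ-≤ (β ℕ.* b) (ℕ.*-monoʳ-≤ α a≤c)))))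
    where
    cancel : ∀ m {x y} → m ℕ.* x ≡ m ℕ.* y → x ≡ y ⊎ m ≡ 0
    cancel zero    _  = inj₂ refl
    cancel (suc m) eq = inj₁ (ℕ.*-cancelˡ-≡ _ _ (suc m) eq)

  embed-injective : ∀ {a b} → embed a ≡ embed b → a ≡ b
  embed-injective {a} {b} eq = cong₂ _,_ (ℤ→ℚ-injective (cong proj₁ eq))
    (cong₂ _,_ (ℤ→ℚ-injective (cong (λ z → proj₁ (proj₂ z)) eq)) (ℤ→ℚ-injective (cong (λ z → proj₂ (proj₂ z)) eq)))

  -- Intersections of segments between track lines.

  module _ {p : ℕ} (p-prime : Prime p) where

    private
      P = point p-prime
      y = y-coord p-prime
      z = z-coord p-prime
      instance _ = prime⇒nonZero p-prime

    -- Taking the fourth end as origin, the meeting point yields a dependency among three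
    -- independent vectors, whose first coefficient is α(γ+δ). Exchanging the ends kills β as well,
    -- which contradicts the positive total weight.
    four-lines-weight : ∀ {q i j k l a b c d} → i ℕ.< p → j ℕ.< p → k ℕ.< p → l ℕ.< p →
      i ≢ j → i ≢ k → i ≢ l → j ≢ k → j ≢ l → k ≢ l →
      (B : Between q (P i a) (P j b)) → Between q (P k c) (P l d) → Between.α B ≡ 0
    four-lines-weight {q} {i} {j} {k} {l} {a} {b} {c} {d} i< j< k< l< i≢j i≢k i≢l j≢k j≢l k≢l
      (between α β s≢0 wx wy wz) (between γ δ s′≢0 wx′ wy′ wz′) =
      weight-zero α (γ ℕ.+ δ) {{s′≢0}}
        (*-zero-cancelʳ (noncoplanar p-prime a b c d i< j< k< l< i≢j i≢k i≢l j≢k j≢l k≢l)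
          (det₃-cramer (+ α * + (γ ℕ.+ δ)) (+ β * + (γ ℕ.+ δ)) (- (+ γ * + (α ℕ.+ β)))
            (+ i - + l) (y i - y l) (z i a - z l d)
            (+ j - + l) (y j - y l) (z j b - z l d)
            (+ k - + l) (y k - y l) (z k c - z l d)
            (shift₄ (+ α) (+ β) (+ γ) (+ δ) (+ i) (+ j) (+ k) (+ l) (weighted-meet α β γ δ wx wx′))
            (shift₄ (+ α) (+ β) (+ γ) (+ δ) (y i) (y j) (y k) (y l) (weighted-meet α β γ δ wy wy′))
            (shift₄ (+ α) (+ β) (+ γ) (+ δ) (z i a) (z j b) (z k c) (z l d) (weighted-meet α β γ δ wz wz′))))

    four-lines-disjoint : ∀ {q i j k l a b c d} → i ℕ.< p → j ℕ.< p → k ℕ.< p → l ℕ.< p →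
      i ≢ j → i ≢ k → i ≢ l → j ≢ k → j ≢ l → k ≢ l →
      Between q (P i a) (P j b) → Between q (P k c) (P l d) → ⊥
    four-lines-disjoint i< j< k< l< i≢j i≢k i≢l j≢k j≢l k≢l B B′ = nonZero-sum⇒⊥ (Between.total B)
      (four-lines-weight i< j< k< l< i≢j i≢k i≢l j≢k j≢l k≢l B B′)
      (four-lines-weight j< i< k< l< (≢-sym i≢j) j≢k j≢l i≢k i≢l k≢l (between-swap B) B′)

    -- Seen from above, both segments start at the foot of line `i` and leave in independent
    -- directions, so they can meet only over that foot.
    three-lines-meet : ∀ {q i j l a b c d} → i ℕ.< p → j ℕ.< p → l ℕ.< p → i ≢ j → i ≢ l → j ≢ l →
      Between q (P i a) (P j b) → Between q (P i c) (P l d) → q ≡ embed (P i a)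
    three-lines-meet {q} {i} {j} {l} {a} {b} {c} {d} i< j< l< i≢j i≢l j≢l
      B@(between α β s≢0 wx wy wz) (between γ δ s′≢0 wx′ wy′ wz′) =
      between-startpoint B (weight-zero β (γ ℕ.+ δ) {{s′≢0}}
        (*-zero-cancelʳ (noncollinear p-prime j< l< i< j≢l (≢-sym i≢j) (≢-sym i≢l))
          (det₂-cramer (+ β * + (γ ℕ.+ δ)) (- (+ δ * + (α ℕ.+ β))) (+ j - + i) (y j - y i) (+ l - + i) (y l - y i)
            (shift₃ (+ α) (+ β) (+ γ) (+ δ) (+ i) (+ j) (+ l) (weighted-meet α β γ δ wx wx′))
            (shift₃ (+ α) (+ β) (+ γ) (+ δ) (y i) (y j) (y l) (weighted-meet α β γ δ wy wy′)))))

    -- At a common point the segments have equal height, although one is weakly below the other at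
    -- both ends. Hence the point is an end, and the two segments share it.
    two-lines-meet : ∀ {q i j a b c d} → i ≢ j → a ℕ.≤ c → b ℕ.≤ d → ¬ (a ≡ c × b ≡ d) →
      Between q (P i a) (P j b) → Between q (P i c) (P j d) →
      (a ≡ c × q ≡ embed (P i a)) ⊎ (b ≡ d × q ≡ embed (P j b))
    two-lines-meet {q} {i} {j} {a} {b} {c} {d} i≢j a≤c b≤d distinct
      B@(between α β s≢0 wx wy wz) (between γ δ s′≢0 wx′ wy′ wz′) =
      conclude (monotone-combination α β a≤c b≤d heights)
      where
      heights : α ℕ.* a ℕ.+ β ℕ.* b ≡ α ℕ.* c ℕ.+ β ℕ.* d
      heights = equal-combinations p (i ℕ.* i ℕ.* i % p) (j ℕ.* j ℕ.* j % p) α β γ δ a b c d i j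
        {{prime⇒nonZero p-prime}} {{s′≢0}} i≢j
        (weighted-meet α β γ δ wx wx′) (weighted-meet α β γ δ wz wz′)
      conclude : (a ≡ c ⊎ α ≡ 0) × (b ≡ d ⊎ β ≡ 0) → (a ≡ c × q ≡ embed (P i a)) ⊎ (b ≡ d × q ≡ embed (P j b))
      conclude (inj₁ a≡c , inj₁ b≡d) = contradiction (a≡c , b≡d) distinct
      conclude (inj₁ a≡c , inj₂ β≡0) = inj₁ (a≡c , between-startpoint B β≡0)
      conclude (inj₂ α≡0 , inj₁ b≡d) = inj₂ (b≡d , between-endpoint B α≡0)
      conclude (inj₂ α≡0 , inj₂ β≡0) = ⊥-elim (nonZero-sum⇒⊥ s≢0 α≡0 β≡0)

    three-lines-weight : ∀ {i j k a b c} → i ℕ.< p → j ℕ.< p → k ℕ.< p → i ≢ j → i ≢ k → j ≢ k →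
      (B : Between (embed (P k c)) (P i a) (P j b)) → Between.α B ≡ 0
    three-lines-weight {i} {j} {k} i< j< k< i≢j i≢k j≢k (between α β s≢0 wx wy wz) =
      ℤ.+-injective (*-zero-cancelʳ (noncollinear p-prime i< j< k< i≢j i≢k j≢k)
        (det₂-cramer (+ α) (+ β) (+ i - + k) (y i - y k) (+ j - + k) (y j - y k)
          (shift₂ (+ α) (+ β) (+ k) (+ i) (+ j) (weighted-at α β (+ k) wx))
          (shift₂ (+ α) (+ β) (y k) (y i) (y j) (weighted-at α β (y k) wy))))

    -- In the x-coordinate the weight β multiplies `j - i`, which is nonzero, so the point must be
    -- the first end.
    on-first-line : ∀ {i j a b c} → i ≢ j → Between (embed (P i c)) (P i a) (P j b) → P i c ≡ P i a
    on-first-line {i} {j} i≢j B@(between α β s≢0 wx wy wz) =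
      embed-injective (between-startpoint B (ℤ.+-injective
        (*-zero-cancelʳ (λ eq → i≢j (sym (ℤ.+-injective (ℤ.i-j≡0⇒i≡j (+ j) (+ i) eq))))
          (trans (identity (+ α) (+ β) (+ i) (+ j)) (shift₂ (+ α) (+ β) (+ i) (+ i) (+ j) (weighted-at α β (+ i) wx))))))
      where
      identity : ∀ α β i j → β * (j - i) ≡ α * (i - i) + β * (j - i)
      identity = solve-∀

    vertex-on-segment : ∀ {i j k a b c} → i ℕ.< p → j ℕ.< p → k ℕ.< p → i ≢ j →
      Between (embed (P k c)) (P i a) (P j b) → P k c ≡ P i a ⊎ P k c ≡ P j b
    vertex-on-segment {i} {j} {k} i< j< k< i≢j B with k ℕ.≟ i | k ℕ.≟ j
    ... | yes refl | _ = inj₁ (on-first-line i≢j B)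
    ... | no _ | yes refl = inj₂ (on-first-line (≢-sym i≢j) (between-swap B))
    ... | no k≢i | no k≢j = ⊥-elim (nonZero-sum⇒⊥ (Between.total B)
      (three-lines-weight i< j< k< i≢j (≢-sym k≢i) (≢-sym k≢j) B)
      (three-lines-weight j< i< k< (≢-sym i≢j) (≢-sym k≢j) (≢-sym k≢i) (between-swap B)))

open Geometry

-- Counting vertices with a decidable property.

indicator : ∀ {A : Set} → Dec A → ℕ
indicator (yes _) = 1
indicator (no _)  = 0

indicator-mono : ∀ {A B : Set} (A? : Dec A) (B? : Dec B) → (A → B) → indicator A? ℕ.≤ indicator B?
indicator-mono (yes a) (yes _) _   = ℕ.≤-refl
indicator-mono (yes a) (no ¬b) A⇒B = contradiction (A⇒B a) ¬b
indicator-mono (no _)  _       _   = ℕ.z≤n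

indicator-< : ∀ {A B : Set} (A? : Dec A) (B? : Dec B) → ¬ A → B → indicator A? ℕ.< indicator B?
indicator-< (yes a) _       ¬a _ = contradiction a ¬a
indicator-< (no _)  (yes _) _  _ = ℕ.s≤s ℕ.z≤n
indicator-< (no _)  (no ¬b) _  b = contradiction b ¬b

count : ∀ {n} {A : Fin n → Set} → (∀ u → Dec (A u)) → ℕ
count {zero}  A? = 0
count {suc n} A? = indicator (A? zero) ℕ.+ count (A? ∘ suc)

count≤n : ∀ {n} {A : Fin n → Set} (A? : ∀ u → Dec (A u)) → count A? ℕ.≤ n
count≤n {zero}  A? = ℕ.z≤n
count≤n {suc n} A? with A? zero
... | yes _ = ℕ.s≤s (count≤n (A? ∘ suc))
... | no  _ = ℕ.m≤n⇒m≤1+n (count≤n (A? ∘ suc))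

count-mono : ∀ {n} {A B : Fin n → Set} (A? : ∀ u → Dec (A u)) (B? : ∀ u → Dec (B u)) →
  (∀ u → A u → B u) → count A? ℕ.≤ count B?
count-mono {zero}  A? B? A⇒B = ℕ.z≤n
count-mono {suc n} A? B? A⇒B =
  ℕ.+-mono-≤ (indicator-mono (A? zero) (B? zero) (A⇒B zero)) (count-mono (A? ∘ suc) (B? ∘ suc) (λ u → A⇒B (suc u)))

count-< : ∀ {n} {A B : Fin n → Set} (A? : ∀ u → Dec (A u)) (B? : ∀ u → Dec (B u)) →
  (∀ u → A u → B u) → ∀ u → ¬ A u → B u → count A? ℕ.< count B?
count-< A? B? A⇒B zero ¬a b =
  ℕ.+-mono-<-≤ (indicator-< (A? zero) (B? zero) ¬a b) (count-mono (A? ∘ suc) (B? ∘ suc) (λ u → A⇒B (suc u)))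
count-< A? B? A⇒B (suc u) ¬a b =
  ℕ.+-mono-≤-< (indicator-mono (A? zero) (B? zero) (A⇒B zero)) (count-< (A? ∘ suc) (B? ∘ suc) (λ u → A⇒B (suc u)) u ¬a b)

inBox-coordinate : ∀ {k X} → k ℕ.< X → + 0 ℤ.≤ + k × + k ℤ.≤ + 0 ℤ.+ + X ℤ.- + 1
inBox-coordinate {k} {suc X} (ℕ.s≤s k≤X) = ℤ.+≤+ ℕ.z≤n , ℤ.+≤+ k≤X

-- Refinement of a track layout into short tracks.

module RankedTracks {n t : ℕ} {G : Graph n} (L : TrackLayout G t) (h : ℕ) .{{h≢0 : NonZero h}} where

  open TrackLayout L

  track : Fin n → ℕ
  track v = toℕ (τ v)

  infix 4 _≺_
  _≺_ : Fin n → Fin n → Set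
  u ≺ v = track u ℕ.< track v ⊎ (track u ≡ track v × pos u ℕ.< pos v)

  _≺?_ : ∀ u v → Dec (u ≺ v)
  u ≺? v = (track u ℕ.<? track v) ⊎-dec ((track u ℕ.≟ track v) ×-dec (pos u ℕ.<? pos v))

  ≺-irrefl : ∀ v → ¬ v ≺ v
  ≺-irrefl v (inj₁ lt)       = ℕ.<-irrefl refl lt
  ≺-irrefl v (inj₂ (_ , lt)) = ℕ.<-irrefl refl lt

  ≺-trans : ∀ {u v w} → u ≺ v → v ≺ w → u ≺ w
  ≺-trans (inj₁ a)       (inj₁ b)        = inj₁ (ℕ.<-trans a b)
  ≺-trans (inj₁ a)       (inj₂ (e , _))  = inj₁ (subst (_ ℕ.<_) e a)
  ≺-trans (inj₂ (e , _)) (inj₁ b)        = inj₁ (subst (ℕ._< _) (sym e) b)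
  ≺-trans (inj₂ (e , a)) (inj₂ (e′ , b)) = inj₂ (trans e e′ , ℕ.<-trans a b)

  -- Counting predecessors gives the place of a vertex in the lexicographic order without building a
  -- sorted list.
  rank : Fin n → ℕ
  rank v = count (_≺? v)

  rank≤n : ∀ v → rank v ℕ.≤ n
  rank≤n v = count≤n (_≺? v)

  rank-mono-< : ∀ {u v} → u ≺ v → rank u ℕ.< rank v
  rank-mono-< {u} {v} u≺v = count-< (_≺? u) (_≺? v) (λ w w≺u → ≺-trans {w} w≺u u≺v) u (≺-irrefl u) u≺v

  -- Adding the block number separates distinct tracks, because rank increases from track to track,
  -- and yet uses at most t + n/h labels.
  label : Fin n → ℕ
  label v = track v ℕ.+ rank v / h

  height : Fin n → ℕ
  height v = rank v % h

  height<h : ∀ v → height v ℕ.< h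
  height<h v = m%n<n (rank v) h

  label<t+n/h : ∀ v → label v ℕ.< t ℕ.+ n / h
  label<t+n/h v = ℕ.+-mono-<-≤ (toℕ<n (τ v)) (/-monoˡ-≤ h (rank≤n v))

  label-mono-< : ∀ {u v} → track u ℕ.< track v → label u ℕ.< label v
  label-mono-< lt = ℕ.+-mono-<-≤ lt (/-monoˡ-≤ h (ℕ.<⇒≤ (rank-mono-< (inj₁ lt))))

  label⇒track : ∀ {u v} → label u ≡ label v → track u ≡ track v
  label⇒track {u} {v} eq with ℕ.<-cmp (track u) (track v)
  ... | tri< lt _ _ = contradiction eq (ℕ.<⇒≢ (label-mono-< lt))
  ... | tri≈ _ e _  = e
  ... | tri> _ _ gt = contradiction (sym eq) (ℕ.<⇒≢ (label-mono-< gt))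

  label⇒τ : ∀ {u v} → label u ≡ label v → τ u ≡ τ v
  label⇒τ {u} {v} eq = toℕ-injective (label⇒track {u} {v} eq)

  -- Equal labels mean equal tracks, hence equal block numbers; within one block the remainders are
  -- ordered as the ranks are.
  height-mono-< : ∀ {u v} → label u ≡ label v → pos u ℕ.< pos v → height u ℕ.< height v
  height-mono-< {u} {v} eq lt = ℕ.+-cancelʳ-< (rank v / h ℕ.* h) (height u) (height v) (begin-strict
    rank u % h ℕ.+ rank v / h ℕ.* h   ≡⟨ cong (λ k → rank u % h ℕ.+ k ℕ.* h) (sym quotients) ⟩
    rank u % h ℕ.+ rank u / h ℕ.* h   ≡⟨ sym (m≡m%n+[m/n]*n (rank u) h) ⟩
    rank u                            <⟨ rank-mono-< (inj₂ (tracks , lt)) ⟩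
    rank v                            ≡⟨ m≡m%n+[m/n]*n (rank v) h ⟩
    rank v % h ℕ.+ rank v / h ℕ.* h ∎)
    where
    open ℕ.≤-Reasoning
    tracks : track u ≡ track v
    tracks = label⇒track {u} {v} eq
    quotients : rank u / h ≡ rank v / h
    quotients = ℕ.+-cancelˡ-≡ (track u) _ _ (trans eq (cong (ℕ._+ rank v / h) (sym tracks)))

  height-injective : ∀ {u v} → label u ≡ label v → height u ≡ height v → u ≡ v
  height-injective {u} {v} eq heq with ℕ.<-cmp (pos u) (pos v)
  ... | tri< lt _ _ = contradiction heq (ℕ.<⇒≢ (height-mono-< eq lt))
  ... | tri≈ _ e _  = pos-inj u v (label⇒τ eq) e
  ... | tri> _ _ gt = contradiction (sym heq) (ℕ.<⇒≢ (height-mono-< (sym eq) gt))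

  height-mono-≤ : ∀ {u v} → label u ≡ label v → pos u ℕ.≤ pos v → height u ℕ.≤ height v
  height-mono-≤ {u} {v} eq le with ℕ.m≤n⇒m<n∨m≡n le
  ... | inj₁ lt = ℕ.<⇒≤ (height-mono-< eq lt)
  ... | inj₂ e  = ℕ.≤-reflexive (cong height (pos-inj u v (label⇒τ eq) e))

  -- The absence of X-crossings orders the ends at `w`, `y` in the same way as those at `v`, `x`. If
  -- `v` and `x` have equal positions they coincide, and either order of `w` and `y` will do.
  heights-ordered : ∀ {v w x y} → E G v w → E G x y → label v ≡ label x → label w ≡ label y →
    (height v ℕ.≤ height x × height w ℕ.≤ height y) ⊎ (height x ℕ.≤ height v × height y ℕ.≤ height w)
  heights-ordered {v} {w} {x} {y} vw xy v∼x w∼y with ℕ.<-cmp (pos v) (pos x)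
  ... | tri< lt _ _ = inj₁ (height-mono-≤ v∼x (ℕ.<⇒≤ lt) ,
          height-mono-≤ w∼y (ℕ.≮⇒≥ (no-X v w x y vw xy (label⇒τ v∼x) (label⇒τ w∼y) lt)))
  ... | tri> _ _ gt = inj₂ (height-mono-≤ (sym v∼x) (ℕ.<⇒≤ gt) ,
          height-mono-≤ (sym w∼y) (ℕ.≮⇒≥ (no-X x y v w xy vw (label⇒τ (sym v∼x)) (label⇒τ (sym w∼y)) gt)))
  ... | tri≈ _ e _ = Sum.map
          (λ le → height-mono-≤ v∼x (ℕ.≤-reflexive e) , height-mono-≤ w∼y le)
          (λ ge → height-mono-≤ (sym v∼x) (ℕ.≤-reflexive (sym e)) , height-mono-≤ (sym w∼y) ge)
          (ℕ.≤-total (pos w) (pos y))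

  edge-labels : ∀ {v w} → E G v w → label v ≢ label w
  edge-labels {v} {w} vw eq = no-intra v w vw (label⇒τ eq)

  -- The drawing and its correctness.

  module Placement {p : ℕ} (p-prime : Prime p) (t+n/h≤p : t ℕ.+ n / h ℕ.≤ p) where

    label<p : ∀ v → label v ℕ.< p
    label<p v = ℕ.<-≤-trans (label<t+n/h v) t+n/h≤p

    place : Fin n → Point
    place v = point p-prime (label v) (height v)

    point-injective : ∀ {i j a b} → point p-prime i a ≡ point p-prime j b → i ≡ j × a ≡ b
    point-injective {i} {j} {a} {b} eq = i≡j , a≡b
      where
      instance _ = prime⇒nonZero p-prime
      i≡j : i ≡ j
      i≡j = ℤ.+-injective (cong proj₁ eq)
      a≡b : a ≡ b
      a≡b = ℕ.*-cancelˡ-≡ a b p (ℕ.+-cancelʳ-≡ (j ℕ.* j ℕ.* j % p) (p ℕ.* a) (p ℕ.* b)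
        (trans (cong (λ k → p ℕ.* a ℕ.+ k ℕ.* k ℕ.* k % p) (sym i≡j))
          (ℤ.+-injective (cong (λ z → proj₂ (proj₂ z)) eq))))

    place-injective : ∀ u v → place u ≡ place v → u ≡ v
    place-injective u v eq = height-injective (proj₁ both) (proj₂ both)
      where both = point-injective {label u} {label v} {height u} {height v} eq

    Common : PointQ → Fin n → Fin n → Fin n → Fin n → Set
    Common q v w x y = ∃[ u ] ((u ≡ v ⊎ u ≡ w) × (u ≡ x ⊎ u ≡ y) × q ≡ embed (place u))

    common-track : ∀ {q v w x y} → E G v w → E G x y → ¬ (v ≡ x × w ≡ y) → label v ≡ label x →
      Between q (place v) (place w) → Between q (place x) (place y) → Common q v w x y
    common-track {q} {v} {w} {x} {y} vw xy distinct v∼x B B′ = split (label w ℕ.≟ label y)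
      where
      at-v : q ≡ embed (place v) → v ≡ x → Common q v w x y
      at-v q≡v v≡x = v , inj₁ refl , inj₁ v≡x , q≡v

      at-w : q ≡ embed (place w) → w ≡ y → Common q v w x y
      at-w q≡w w≡y = w , inj₂ refl , inj₂ w≡y , q≡w

      -- The second segment is rewritten to start on the line of `label v`, so that the geometric
      -- lemmas see one shared line.
      B″ : Between q (point p-prime (label v) (height x)) (place y)
      B″ = subst (λ l → Between q (point p-prime l (height x)) (place y)) (sym v∼x) B′

      same-tracks : label w ≡ label y → Common q v w x y
      same-tracks w∼y = [ upward , downward ]′ (heights-ordered vw xy v∼x w∼y)
        where
        B‴ : Between q (point p-prime (label v) (height x)) (point p-prime (label w) (height y))
        B‴ = subst (λ l → Between q (point p-prime (label v) (height x)) (point p-prime l (height y))) (sym w∼y) B″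
        upward : height v ℕ.≤ height x × height w ℕ.≤ height y → Common q v w x y
        upward (v≤x , w≤y) = [ (λ { (e , q≡) → at-v q≡ (height-injective v∼x e) })
                             , (λ { (e , q≡) → at-w q≡ (height-injective w∼y e) }) ]′
          (two-lines-meet p-prime (edge-labels vw) v≤x w≤y
            (λ { (e , e′) → distinct (height-injective v∼x e , height-injective w∼y e′) }) B B‴)
        downward : height x ℕ.≤ height v × height y ℕ.≤ height w → Common q v w x y
        downward (x≤v , y≤w) = [ (λ { (e , q≡) → at-v (trans q≡ (cong (λ a → embed (point p-prime (label v) a)) e)) (height-injective v∼x (sym e)) })
                               , (λ { (e , q≡) → at-w (trans q≡ (cong (λ a → embed (point p-prime (label w) a)) e)) (height-injective w∼y (sym e)) }) ]′
          (two-lines-meet p-prime (edge-labels vw) x≤v y≤w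
            (λ { (e , e′) → distinct (height-injective v∼x (sym e) , height-injective w∼y (sym e′)) }) B‴ B)

      different-tracks : label w ≢ label y → Common q v w x y
      -- Used once from each segment, the three-line lemma puts `q` at both `place v` and `place x`,
      -- so these vertices coincide.
      different-tracks w≁y = at-v q≡v (place-injective v x (embed-injective (trans (sym q≡v) q≡x)))
        where
        v≁y : label v ≢ label y
        v≁y eq = edge-labels xy (trans (sym v∼x) eq)
        q≡v : q ≡ embed (place v)
        q≡v = three-lines-meet p-prime (label<p v) (label<p w) (label<p y) (edge-labels vw) v≁y w≁y B B″
        q≡x : q ≡ embed (place x)
        q≡x = trans (three-lines-meet p-prime (label<p v) (label<p y) (label<p w) v≁y (edge-labels vw) (≢-sym w≁y) B″ B)
                (cong (λ l → embed (point p-prime l (height x))) v∼x)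

      split : Dec (label w ≡ label y) → Common q v w x y
      split (yes w∼y) = same-tracks w∼y
      split (no w≁y)  = different-tracks w≁y

    swapˡ : ∀ {q v w x y} → Common q w v x y → Common q v w x y
    swapˡ (u , a , b , c) = u , Sum.swap a , b , c

    swapʳ : ∀ {q v w x y} → Common q v w y x → Common q v w x y
    swapʳ (u , a , b , c) = u , a , Sum.swap b , c

    -- Reversing one or both edges moves a shared track to the first position. If no track is
    -- shared, the four ends lie on distinct lines and the segments are disjoint.
    edges-meet : ∀ {q v w x y} → E G v w → E G x y →
      ¬ ((v ≡ x × w ≡ y) ⊎ (v ≡ y × w ≡ x)) →
      Between q (place v) (place w) → Between q (place x) (place y) → Common q v w x y
    edges-meet {q} {v} {w} {x} {y} vw xy distinct B B′ =
      split (label v ℕ.≟ label x) (label v ℕ.≟ label y) (label w ℕ.≟ label x) (label w ℕ.≟ label y)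
      where
      split : Dec (label v ≡ label x) → Dec (label v ≡ label y) →
              Dec (label w ≡ label x) → Dec (label w ≡ label y) → Common q v w x y
      split (yes e) _ _ _ = common-track vw xy (λ s → distinct (inj₁ s)) e B B′
      split _ (yes e) _ _ = swapʳ (common-track vw (E-sym G xy) (λ s → distinct (inj₂ s)) e B (between-swap B′))
      split _ _ (yes e) _ = swapˡ (common-track (E-sym G vw) xy
        (λ { (a , b) → distinct (inj₂ (b , a)) }) e (between-swap B) B′)
      split _ _ _ (yes e) = swapˡ (swapʳ (common-track (E-sym G vw) (E-sym G xy)
        (λ { (a , b) → distinct (inj₁ (b , a)) }) e (between-swap B) (between-swap B′)))
      split (no v≁x) (no v≁y) (no w≁x) (no w≁y) = ⊥-elim
        (four-lines-disjoint p-prime (label<p v) (label<p w) (label<p x) (label<p y)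
          (edge-labels vw) v≁x v≁y w≁x w≁y (edge-labels xy) B B′)

    drawing : Drawing G
    drawing = record
      { p         = place
      ; p-inj     = place-injective
      ; vtx-edge  = λ u v w vw on → Sum.map (place-injective u v) (place-injective u w)
          (vertex-on-segment p-prime (label<p v) (label<p w) (label<p u) (edge-labels vw) (onSeg⇒between on))
      ; edge-edge = λ v w x y vw xy distinct q on on′ →
          edges-meet vw xy distinct (onSeg⇒between on) (onSeg⇒between on′)
      }

    drawing-inBox : InBox drawing p p (p ℕ.* h)
    drawing-inBox = + 0 , + 0 , + 0 , λ v →
      inBox-coordinate (label<p v) , inBox-coordinate (m%n<n (label v ℕ.* label v) p) , inBox-coordinate (Z<ph v)
      where
      open ℕ.≤-Reasoning
      instance _ = prime⇒nonZero p-prime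
      Z<ph : ∀ v → p ℕ.* height v ℕ.+ label v ℕ.* label v ℕ.* label v % p ℕ.< p ℕ.* h
      Z<ph v = begin-strict
        p ℕ.* height v ℕ.+ label v ℕ.* label v ℕ.* label v % p
          <⟨ ℕ.+-monoʳ-< (p ℕ.* height v) (m%n<n (label v ℕ.* label v ℕ.* label v) p) ⟩
        p ℕ.* height v ℕ.+ p
          ≡⟨ trans (ℕ.+-comm (p ℕ.* height v) p) (sym (ℕ.*-suc p (height v))) ⟩
        p ℕ.* suc (height v)
          ≤⟨ ℕ.*-monoʳ-≤ p (height<h v) ⟩
        p ℕ.* h ∎

-- Clearing denominators for r = a/d.

ℕ→ℚ-* : ∀ m n → ℕ→ℚ (m ℕ.* n) ≡ ℕ→ℚ m ℚ.* ℕ→ℚ n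
ℕ→ℚ-* m n = trans (cong ℤ→ℚ (ℤ.pos-* m n)) (ℤ→ℚ-* (+ m) (+ n))

ℕ→ℚ-mono-≤ : ∀ {m n} → m ℕ.≤ n → ℕ→ℚ m ℚ.≤ ℕ→ℚ n
ℕ→ℚ-mono-≤ m≤n = ℤ→ℚ-mono-≤ (ℤ.+≤+ m≤n)

ℕ→ℚ-cancel-≤ : ∀ {m n} → ℕ→ℚ m ℚ.≤ ℕ→ℚ n → m ℕ.≤ n
ℕ→ℚ-cancel-≤ m≤n = ℤ.drop‿+≤+ (ℤ→ℚ-cancel-≤ m≤n)

*-swap-right : ∀ x y z → x ℚ.* y ℚ.* z ≡ x ℚ.* z ℚ.* y
*-swap-right x y z = trans (ℚ.*-assoc x y z) (trans (cong (x ℚ.*_) (ℚ.*-comm y z)) (sym (ℚ.*-assoc x z y)))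

module Fraction {r : ℚ} {a d : ℕ} .{{_ : NonZero d}} (rd≡a : r ℚ.* ℕ→ℚ d ≡ ℕ→ℚ a) where

  cross-multiply : ∀ x → r ℚ.* ℕ→ℚ x ℚ.* ℕ→ℚ d ≡ ℕ→ℚ (a ℕ.* x)
  cross-multiply x = begin
    r ℚ.* ℕ→ℚ x ℚ.* ℕ→ℚ d   ≡⟨ *-swap-right r (ℕ→ℚ x) (ℕ→ℚ d) ⟩
    r ℚ.* ℕ→ℚ d ℚ.* ℕ→ℚ x   ≡⟨ cong (ℚ._* ℕ→ℚ x) rd≡a ⟩
    ℕ→ℚ a ℚ.* ℕ→ℚ x         ≡⟨ sym (ℕ→ℚ-* a x) ⟩
    ℕ→ℚ (a ℕ.* x) ∎
    where open ≡-Reasoning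

  *≤⇒ℕ : ∀ x y → r ℚ.* ℕ→ℚ x ℚ.≤ ℕ→ℚ y → a ℕ.* x ℕ.≤ y ℕ.* d
  *≤⇒ℕ x y rx≤y = ℕ→ℚ-cancel-≤ (subst₂ ℚ._≤_ (cross-multiply x) (sym (ℕ→ℚ-* y d))
    (ℚ.*-monoʳ-≤-nonNeg (ℕ→ℚ d) {{ℚ.pos⇒nonNeg (ℕ→ℚ d)}} rx≤y))

  ≤⇒≤*ℚ : ∀ x k y → x ℕ.* d ℕ.≤ k ℕ.* (a ℕ.* y) → ℕ→ℚ x ℚ.≤ ℕ→ℚ k ℚ.* r ℚ.* ℕ→ℚ y
  ≤⇒≤*ℚ x k y le = ℚ.*-cancelʳ-≤-pos (ℕ→ℚ d) (subst₂ ℚ._≤_ (ℕ→ℚ-* x d) (sym (begin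
    ℕ→ℚ k ℚ.* r ℚ.* ℕ→ℚ y ℚ.* ℕ→ℚ d   ≡⟨ cong (ℚ._* ℕ→ℚ d) (ℚ.*-assoc (ℕ→ℚ k) r (ℕ→ℚ y)) ⟩
    ℕ→ℚ k ℚ.* (r ℚ.* ℕ→ℚ y) ℚ.* ℕ→ℚ d ≡⟨ ℚ.*-assoc (ℕ→ℚ k) (r ℚ.* ℕ→ℚ y) (ℕ→ℚ d) ⟩
    ℕ→ℚ k ℚ.* (r ℚ.* ℕ→ℚ y ℚ.* ℕ→ℚ d) ≡⟨ cong (ℕ→ℚ k ℚ.*_) (cross-multiply y) ⟩
    ℕ→ℚ k ℚ.* ℕ→ℚ (a ℕ.* y)           ≡⟨ sym (ℕ→ℚ-* k (a ℕ.* y)) ⟩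
    ℕ→ℚ (k ℕ.* (a ℕ.* y)) ∎)) (ℕ→ℚ-mono-≤ le))
    where open ≡-Reasoning

  square : r ℚ.* r ℚ.* ℕ→ℚ (d ℕ.* d) ≡ ℕ→ℚ (a ℕ.* a)
  square = begin
    r ℚ.* r ℚ.* ℕ→ℚ (d ℕ.* d)       ≡⟨ cong (r ℚ.* r ℚ.*_) (ℕ→ℚ-* d d) ⟩
    r ℚ.* r ℚ.* (ℕ→ℚ d ℚ.* ℕ→ℚ d)   ≡⟨ sym (ℚ.*-assoc (r ℚ.* r) (ℕ→ℚ d) (ℕ→ℚ d)) ⟩
    r ℚ.* r ℚ.* ℕ→ℚ d ℚ.* ℕ→ℚ d     ≡⟨ cong (ℚ._* ℕ→ℚ d) (ℚ.*-assoc r r (ℕ→ℚ d)) ⟩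
    r ℚ.* (r ℚ.* ℕ→ℚ d) ℚ.* ℕ→ℚ d   ≡⟨ cong (λ s → r ℚ.* s ℚ.* ℕ→ℚ d) rd≡a ⟩
    r ℚ.* ℕ→ℚ a ℚ.* ℕ→ℚ d           ≡⟨ cross-multiply a ⟩
    ℕ→ℚ (a ℕ.* a) ∎
    where open ≡-Reasoning

  square-≤ : ∀ x k y → x ℕ.* (a ℕ.* a) ℕ.≤ k ℕ.* y ℕ.* (d ℕ.* d) → ℕ→ℚ x ℚ.* (r ℚ.* r) ℚ.≤ ℕ→ℚ k ℚ.* ℕ→ℚ y
  square-≤ x k y le = ℚ.*-cancelʳ-≤-pos (ℕ→ℚ (d ℕ.* d)) {{ℕ→ℚ-pos {{ℕ.m*n≢0 d d}}}} (subst₂ ℚ._≤_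
    (trans (ℕ→ℚ-* x (a ℕ.* a)) (trans (cong (ℕ→ℚ x ℚ.*_) (sym square)) (sym (ℚ.*-assoc (ℕ→ℚ x) (r ℚ.* r) (ℕ→ℚ (d ℕ.* d))))))
    (trans (ℕ→ℚ-* (k ℕ.* y) (d ℕ.* d)) (cong (ℚ._* ℕ→ℚ (d ℕ.* d)) (ℕ→ℚ-* k y)))
    (ℕ→ℚ-mono-≤ le))

-- Choice of parameters, volume and aspect ratio.

module Parameters {n t a d : ℕ} .{{d≢0 : NonZero d}} (d≤a : d ℕ.≤ a) (at≤nd : a ℕ.* t ℕ.≤ n ℕ.* d) where

  open ℕ.≤-Reasoning

  -- This is ⌊r⌋ + 1, so r ≤ h ≤ 2r, the upper bound because r ≥ 1. The lower bound limits the
  -- number of blocks, the upper one the box.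
  h : ℕ
  h = suc (a / d)

  a≤hd : a ℕ.≤ h ℕ.* d
  a≤hd = begin
    a                       ≡⟨ m≡m%n+[m/n]*n a d ⟩
    a % d ℕ.+ a / d ℕ.* d   ≤⟨ ℕ.+-monoˡ-≤ (a / d ℕ.* d) (ℕ.<⇒≤ (m%n<n a d)) ⟩
    h ℕ.* d ∎

  hd≤2a : h ℕ.* d ℕ.≤ 2 ℕ.* a
  hd≤2a = begin
    d ℕ.+ a / d ℕ.* d   ≤⟨ ℕ.+-mono-≤ d≤a (m/n*n≤m a d) ⟩
    a ℕ.+ a             ≡⟨ cong (a ℕ.+_) (sym (ℕ.+-identityʳ a)) ⟩
    2 ℕ.* a ∎

  labels : ℕ
  labels = t ℕ.+ n / h

  -- In terms of r this is `labels` ≤ 2n/r: both t ≤ n/r, by assumption, and n/h ≤ n/r.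
  labels*a≤2nd : labels ℕ.* a ℕ.≤ 2 ℕ.* (n ℕ.* d)
  labels*a≤2nd = begin
    (t ℕ.+ n / h) ℕ.* a               ≡⟨ ℕ.*-distribʳ-+ a t (n / h) ⟩
    t ℕ.* a ℕ.+ n / h ℕ.* a           ≤⟨ ℕ.+-mono-≤ (ℕ.≤-reflexive (ℕ.*-comm t a)) (ℕ.*-monoʳ-≤ (n / h) a≤hd) ⟩
    a ℕ.* t ℕ.+ n / h ℕ.* (h ℕ.* d)   ≡⟨ cong (a ℕ.* t ℕ.+_) (sym (ℕ.*-assoc (n / h) h d)) ⟩
    a ℕ.* t ℕ.+ n / h ℕ.* h ℕ.* d     ≤⟨ ℕ.+-mono-≤ at≤nd (ℕ.*-monoˡ-≤ d (m/n*n≤m n h)) ⟩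
    n ℕ.* d ℕ.+ n ℕ.* d               ≡⟨ cong (n ℕ.* d ℕ.+_) (sym (ℕ.+-identityʳ (n ℕ.* d))) ⟩
    2 ℕ.* (n ℕ.* d) ∎

  -- From p ≤ 2Cn/r and h ≤ 2r the volume p³h is at most 8C³n³/r³ · 2r = 16C³n³/r². The proof
  -- carries one more factor `d`, because `h` is bounded only together with it.
  volume-bound : ∀ {p} C → p ℕ.≤ C ℕ.* labels →
    p ℕ.* p ℕ.* (p ℕ.* h) ℕ.* (a ℕ.* a) ℕ.≤ 16 ℕ.* (C ℕ.* C ℕ.* C) ℕ.* (n ^ 3) ℕ.* (d ℕ.* d)
  volume-bound {p} C p≤ = ℕ.*-cancelʳ-≤ _ _ d (begin
    p ℕ.* p ℕ.* (p ℕ.* h) ℕ.* (a ℕ.* a) ℕ.* d              ≡⟨ regroup p h a d ⟩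
    p ℕ.* p ℕ.* p ℕ.* (a ℕ.* a) ℕ.* (h ℕ.* d)              ≤⟨ ℕ.*-monoʳ-≤ (p ℕ.* p ℕ.* p ℕ.* (a ℕ.* a)) hd≤2a ⟩
    p ℕ.* p ℕ.* p ℕ.* (a ℕ.* a) ℕ.* (2 ℕ.* a)              ≡⟨ cube p a ⟩
    2 ℕ.* (p ℕ.* a ℕ.* (p ℕ.* a) ℕ.* (p ℕ.* a))            ≤⟨ ℕ.*-monoʳ-≤ 2 (ℕ.*-mono-≤ (ℕ.*-mono-≤ pa≤ pa≤) pa≤) ⟩
    2 ℕ.* (b ℕ.* b ℕ.* b)                                  ≡⟨ expand C n d ⟩
    16 ℕ.* (C ℕ.* C ℕ.* C) ℕ.* (n ^ 3) ℕ.* (d ℕ.* d) ℕ.* d ∎)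
    where
    b = C ℕ.* (2 ℕ.* (n ℕ.* d))
    pa≤ : p ℕ.* a ℕ.≤ b
    pa≤ = begin
      p ℕ.* a                  ≤⟨ ℕ.*-monoˡ-≤ a p≤ ⟩
      C ℕ.* labels ℕ.* a       ≡⟨ ℕ.*-assoc C labels a ⟩
      C ℕ.* (labels ℕ.* a)     ≤⟨ ℕ.*-monoʳ-≤ C labels*a≤2nd ⟩
      b ∎
    regroup : ∀ p h a d → p ℕ.* p ℕ.* (p ℕ.* h) ℕ.* (a ℕ.* a) ℕ.* d ≡ p ℕ.* p ℕ.* p ℕ.* (a ℕ.* a) ℕ.* (h ℕ.* d)
    regroup = ℕ-Solver.solve-∀
    cube : ∀ p a → p ℕ.* p ℕ.* p ℕ.* (a ℕ.* a) ℕ.* (2 ℕ.* a) ≡ 2 ℕ.* (p ℕ.* a ℕ.* (p ℕ.* a) ℕ.* (p ℕ.* a))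
    cube = ℕ-Solver.solve-∀
    expand : ∀ C n d → 2 ℕ.* (C ℕ.* (2 ℕ.* (n ℕ.* d)) ℕ.* (C ℕ.* (2 ℕ.* (n ℕ.* d))) ℕ.* (C ℕ.* (2 ℕ.* (n ℕ.* d))))
      ≡ 16 ℕ.* (C ℕ.* C ℕ.* C) ℕ.* (n ℕ.* (n ℕ.* (n ℕ.* 1))) ℕ.* (d ℕ.* d) ℕ.* d
    expand = ℕ-Solver.solve-∀

  -- As h ≥ 1, the longest side is `p * h` and the shortest is `p`, so the ratio is h ≤ 2r.
  aspect-bound : ∀ p → (p ⊔ p ⊔ p ℕ.* h) ℕ.* d ℕ.≤ 2 ℕ.* (a ℕ.* (p ⊓ p ⊓ (p ℕ.* h)))
  aspect-bound p = begin
    (p ⊔ p ⊔ p ℕ.* h) ℕ.* d   ≡⟨ cong (ℕ._* d) (trans (cong (_⊔ p ℕ.* h) (ℕ.⊔-idem p)) (ℕ.m≤n⇒m⊔n≡n p≤ph)) ⟩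
    p ℕ.* h ℕ.* d             ≡⟨ ℕ.*-assoc p h d ⟩
    p ℕ.* (h ℕ.* d)           ≤⟨ ℕ.*-monoʳ-≤ p hd≤2a ⟩
    p ℕ.* (2 ℕ.* a)           ≡⟨ trans (ℕ.*-comm p (2 ℕ.* a)) (ℕ.*-assoc 2 a p) ⟩
    2 ℕ.* (a ℕ.* p)           ≡⟨ cong (λ k → 2 ℕ.* (a ℕ.* k)) (sym (trans (cong (_⊓ (p ℕ.* h)) (ℕ.⊓-idem p)) (ℕ.m≤n⇒m⊓n≡m p≤ph))) ⟩
    2 ℕ.* (a ℕ.* (p ⊓ p ⊓ (p ℕ.* h))) ∎
    where
    p≤ph : p ℕ.≤ p ℕ.* h
    p≤ph = ℕ.m≤m*n p h

-- Assembly of the theorem.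

track-exists : ∀ {n t} {G : Graph n} → 1 ℕ.≤ n → TrackLayout G t → 1 ℕ.≤ t
track-exists {suc n} {zero}  _ L with TrackLayout.τ L zero
... | ()
track-exists {suc n} {suc t} _ L = ℕ.s≤s ℕ.z≤n

theorem2p14 : ∃[ c ] (∀ (n : ℕ) → 1 ℕ.≤ n → (G : Graph n) → (t : ℕ) → IsTrackNumber G t →
    ∀ (r : ℚ) → 1ℚ ℚ.≤ r → r ℚ.* ℕ→ℚ t ℚ.≤ ℕ→ℚ n →
    ∃[ D ] ∃[ X ] ∃[ Y ] ∃[ Z ]
    (1 ℕ.≤ X × 1 ℕ.≤ Y × 1 ℕ.≤ Z × InBox {n} {G} D X Y Z ×
    ℕ→ℚ (X ℕ.* Y ℕ.* Z) ℚ.* (r ℚ.* r) ℚ.≤ c ℚ.* ℕ→ℚ (n ^ 3) ×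
    ℕ→ℚ (X ⊔ Y ⊔ Z) ℚ.≤ (ℕ→ℚ 2 ℚ.* r) ℚ.* ℕ→ℚ (X ⊓ Y ⊓ Z)))
theorem2p14 = from-bertrand WeakBertrand.weak-bertrand
  where
  from-bertrand : ∃[ C ] (∀ T → 1 ℕ.≤ T → ∃[ p ] (Prime p × T ℕ.≤ p × p ℕ.≤ C ℕ.* T)) → _
  from-bertrand (C , prime-above) = ℕ→ℚ (16 ℕ.* (C ℕ.* C ℕ.* C)) , λ n 1≤n G t (L , _) r 1≤r rt≤n →
    let
      d = ℚ.↧ₙ r
      -- Since r ≥ 1, the numerator is positive and equals its absolute value.
      a = ∣ ℚ.↥ r ∣
      d≤↥r : + d ℤ.≤ ℚ.↥ r
      d≤↥r = subst₂ ℤ._≤_ (ℤ.*-identityˡ (+ d)) (ℤ.*-identityʳ (ℚ.↥ r)) (ℚ.drop-*≤* 1≤r)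
      +a≡↥r : + a ≡ ℚ.↥ r
      +a≡↥r = ℤ.0≤i⇒+∣i∣≡i (ℤ.≤-trans (ℤ.+≤+ ℕ.z≤n) d≤↥r)
      rd≡a : r ℚ.* ℕ→ℚ d ≡ ℕ→ℚ a
      rd≡a = trans (*-denominator r) (cong ℤ→ℚ (sym +a≡↥r))
      d≤a : d ℕ.≤ a
      d≤a = ℤ.drop‿+≤+ (subst (+ d ℤ.≤_) (sym +a≡↥r) d≤↥r)
      module F = Fraction {r} {a} {d} rd≡a
      at≤nd = F.*≤⇒ℕ t n rt≤n
      module P = Parameters {n} {t} {a} {d} d≤a at≤nd
      -- Some vertex has a track, so t ≥ 1 and the prime search starts from a positive number. A
      -- prime of at least `P.labels` keeps all labels distinct modulo `p`.
      p , p-prime , labels≤p , p≤ = prime-above P.labels (ℕ.≤-trans (track-exists 1≤n L) (ℕ.m≤m+n t (n ℕ./ P.h)))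
      module D = RankedTracks.Placement L P.h p-prime labels≤p
      1≤p = ℕ.>-nonZero⁻¹ p {{prime⇒nonZero p-prime}}
    in D.drawing , p , p , p ℕ.* P.h , 1≤p , 1≤p , ℕ.*-mono-≤ 1≤p (ℕ.s≤s {0} ℕ.z≤n) , D.drawing-inBox
       , F.square-≤ (p ℕ.* p ℕ.* (p ℕ.* P.h)) (16 ℕ.* (C ℕ.* C ℕ.* C)) (n ^ 3) (P.volume-bound C p≤)
       , F.≤⇒≤*ℚ (p ⊔ p ⊔ (p ℕ.* P.h)) 2 (p ⊓ p ⊓ (p ℕ.* P.h)) (P.aspect-bound p)
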